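{- Let $n>2$ be an integer, $q=2^n$, $b\in\mathbb{F}_{q^2}^{*}$, $a_1\in\mathbb{F}_q^{*}$ and $a_2,a_3\in\mathbb{F}_{q^2}^{*}$ such that $a_1,a_2,a_3$ are pairwise different and $a_1+a_2+a_3\ne 0$. For $i=1,2,3$ let $f_i(x)={\rm Tr}_1^{2n}\!\left(\frac{a_i}{x^{q-1}+b}\right)$ for $x\in\mathbb{F}_{q^2}$, and let $h_3=f_1f_2+f_1f_3+f_2f_3$. Then $h_3$ is bent if one of the following conditions is satisfied: (1) $b=1$, $a_2\in\mathbb{F}_q^{*}$, $a_3\notin\mathbb{F}_q$, ${\rm Tr}_1^n(a_1+a_2)=1$; (2) $b=1$, $a_2\notin\mathbb{F}_q$, $a_3\notin\mathbb{F}_q$, $a_2+a_3\in\mathbb{F}_q$, ${\rm Tr}_1^n(a_2+a_3)=0$ and ${\rm Tr}_1^{2n}(a_2)=0$; (3) $b\in U\setminus\{1\}$, ${\rm Tr}_n^{2n}(a_2\overline{b})={\rm Tr}_n^{2n}(a_3\overline{b})=0$, ${\rm Tr}_1^n(a_2\overline{a_2}+a_3\overline{a_3})=1$ and $h_3(0)=0$; (4) $b\in U\setminus\{1\}$, ${\rm Tr}_n^{2n}(a_2\overline{b})=0$, ${\rm Tr}_n^{2n}(a_3\overline{b})\ne 0$, ${\rm Tr}_n^{2n}((a_1+a_2+a_3)\overline{b})=0$, ${\rm Tr}_1^n(a_2\overline{a_2})={\rm Tr}_1^n((a_1+a_2+a_3)(a_1+\overline{a_2}+\overline{a_3}))$ and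 $h_3(0)=0$; (5) $b\in U\setminus\{1\}$, ${\rm Tr}_n^{2n}(a_2\overline{b})\ne0$, ${\rm Tr}_n^{2n}(a_3\overline{b})\ne0$, ${\rm Tr}_n^{2n}((a_1+a_2+a_3)\overline{b})\ne0$ and $h_3(0)=0$; (6) $b\notin U$ and $2(-1)^{h_3(0)}=2(-1)^{u(a_1)u(a_2)+u(a_1)u(a_3)+u(a_2)u(a_3)}+(-1)^{u(a_1+a_2+a_3)}k(a_1+a_2+a_3)-\sum_{i=1}^{3}(-1)^{u(a_i)}k(a_i)$, where $k(x)=\mathcal{K}_n\!\left(\frac{x\overline{x}}{1+b^2\overline{b}^2}\right)$ and $u(x)={\rm Tr}_1^{2n}\!\left(\frac{\overline{x}b}{1+b\overline{b}}\right)$.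
   Context: For $k\mid m$, ${\rm Tr}_k^m(x)=x+x^{2^k}+\dots+x^{2^{(m/k-1)k}}$ is the trace from $\mathbb{F}_{2^m}$ to $\mathbb{F}_{2^k}$; values in $\mathbb{F}_2$ in exponents of $-1$ are read as integers $0,1$. For $x\in\mathbb{F}_{q^2}$, $\overline{x}=x^{q}$. $U=\{\eta\in\mathbb{F}_{q^2}:\eta^{q+1}=1\}$. Convention: $\frac{1}{0}=0$. The binary Kloosterman sum is $\mathcal{K}_n(a)=\sum_{x\in\mathbb{F}_{2^n}}(-1)^{{\rm Tr}_1^n(1/x+ax)}$ for $a\in\mathbb{F}_{2^n}^*$. A function $f:\mathbb{F}_{2^{2n}}\to\mathbb{F}_2$ is bent if $\left(\sum_{x}(-1)^{f(x)+{\rm Tr}_1^{2n}(\omega x)}\right)^2=2^{2n}$ for all $\omega\in\mathbb{F}_{2^{2n}}$. -}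

module Defs where

open import Level using (0ℓ)
open import Data.Nat as ℕ using (ℕ; zero; suc)
open import Data.Integer as ℤ using (ℤ)
open import Data.List using (List; []; _∷_; length; filter; map)
open import Data.List.Relation.Unary.Unique.Propositional using (Unique)
open import Data.List.Membership.Propositional using (_∈_)
open import Data.Product using (_×_; _,_)
open import Data.Sum using (_⊎_)
open import Relation.Nullary using (¬_; Dec; yes; no)
open import Relation.Binary.PropositionalEquality using (_≡_; _≢_)
open import Algebra.Structures using (IsCommutativeRing)

record GF2^ (m : ℕ) : Set₁ where
  infixl 6 _+_
  infixl 7 _*_
  field
    Carrier : Set
    _≟_     : (x y : Carrier) → Dec (x ≡ y)
    _+_ _*_ : Carrier → Carrier → Carrier
    -_      : Carrier → Carrier
    0# 1#   : Carrier
    inv     : Carrier → Carrier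
    isCommutativeRing : IsCommutativeRing _≡_ _+_ _*_ -_ 0# 1#
    1≢0     : 1# ≢ 0#
    inv-r   : ∀ x → x ≢ 0# → x * inv x ≡ 1#
    inv-0   : inv 0# ≡ 0#
    char2   : 1# + 1# ≡ 0#
    elems   : List Carrier
    elems-complete : ∀ x → x ∈ elems
    elems-unique   : Unique elems
    elems-card     : length elems ≡ 2 ℕ.^ m

  -- division with convention x/0 = 0
  _/_ : Carrier → Carrier → Carrier
  x / y = x * inv y

  _^_ : Carrier → ℕ → Carrier
  x ^ zero  = 1#
  x ^ suc k = x * (x ^ k)

  traceSum : ℕ → ℕ → Carrier → Carrier
  traceSum d zero    x = 0#
  traceSum d (suc k) x = (x ^ (2 ℕ.^ (k ℕ.* d))) + traceSum d k x

  -- (-1)^t for t ∈ F_2 ⊆ Carrier, read as integer 0/1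
  sgn : Carrier → ℤ
  sgn t with t ≟ 0#
  ... | yes _ = ℤ.+ 1
  ... | no  _ = ℤ.- (ℤ.+ 1)

  Σℤ : List Carrier → (Carrier → ℤ) → ℤ
  Σℤ []       f = ℤ.+ 0
  Σℤ (x ∷ xs) f = f x ℤ.+ Σℤ xs f

module Setting (n : ℕ) (F : GF2^ (2 ℕ.* n)) where
  open GF2^ F public

  q : ℕ
  q = 2 ℕ.^ n

  conj : Carrier → Carrier
  conj x = x ^ q

  InFq : Carrier → Set
  InFq x = conj x ≡ x

  InU : Carrier → Set
  InU x = x ^ (q ℕ.+ 1) ≡ 1#

  Tr2n : Carrier → Carrier
  Tr2n = traceSum 1 (2 ℕ.* n)

  -- Tr_1^n : F_q → F_2 (applied to elements of F_q)
  Trn : Carrier → Carrier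
  Trn = traceSum 1 n

  Trn2n : Carrier → Carrier
  Trn2n = traceSum n 2

  Fq-elems : List Carrier
  Fq-elems = filter (λ x → conj x ≟ x) elems

  Kloosterman : Carrier → ℤ
  Kloosterman a = Σℤ Fq-elems (λ x → sgn (Trn (inv x + a * x)))

  -- Walsh transform of a Boolean function with values in F_2 ⊆ Carrier
  walsh : (Carrier → Carrier) → Carrier → ℤ
  walsh f ω = Σℤ elems (λ x → sgn (f x + Tr2n (ω * x)))

  Bent : (Carrier → Carrier) → Set
  Bent f = ∀ ω → walsh f ω ℤ.* walsh f ω ≡ ℤ.+ (2 ℕ.^ (2 ℕ.* n))

  fa : Carrier → Carrier → Carrier → Carrier
  fa b a x = Tr2n (a / ((x ^ (q ℕ.∸ 1)) + b))

  h3 : Carrier → Carrier → Carrier → Carrier → Carrier → Carrier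
  h3 b a₁ a₂ a₃ x =
    fa b a₁ x * fa b a₂ x + fa b a₁ x * fa b a₃ x + fa b a₂ x * fa b a₃ x

  kfun : Carrier → Carrier → ℤ
  kfun b x = Kloosterman ((x * conj x) / (1# + (b * b) * (conj b * conj b)))

  ufun : Carrier → Carrier → Carrier
  ufun b x = Tr2n ((conj x * b) / (1# + b * conj b))

  Cond1 Cond2 Cond3 Cond4 Cond5 Cond6 : Carrier → Carrier → Carrier → Carrier → Set
  Cond1 b a₁ a₂ a₃ =
    b ≡ 1# × (InFq a₂ × a₂ ≢ 0#) × ¬ InFq a₃ × Trn (a₁ + a₂) ≡ 1#
  Cond2 b a₁ a₂ a₃ =
    b ≡ 1# × ¬ InFq a₂ × ¬ InFq a₃ × InFq (a₂ + a₃)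
      × Trn (a₂ + a₃) ≡ 0# × Tr2n a₂ ≡ 0#
  Cond3 b a₁ a₂ a₃ =
    (InU b × b ≢ 1#) × Trn2n (a₂ * conj b) ≡ 0# × Trn2n (a₃ * conj b) ≡ 0#
      × Trn (a₂ * conj a₂ + a₃ * conj a₃) ≡ 1# × h3 b a₁ a₂ a₃ 0# ≡ 0#
  Cond4 b a₁ a₂ a₃ =
    (InU b × b ≢ 1#) × Trn2n (a₂ * conj b) ≡ 0# × Trn2n (a₃ * conj b) ≢ 0#
      × Trn2n ((a₁ + a₂ + a₃) * conj b) ≡ 0#
      × Trn (a₂ * conj a₂) ≡ Trn ((a₁ + a₂ + a₃) * (a₁ + conj a₂ + conj a₃))
      × h3 b a₁ a₂ a₃ 0# ≡ 0#
  Cond5 b a₁ a₂ a₃ =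
    (InU b × b ≢ 1#) × Trn2n (a₂ * conj b) ≢ 0# × Trn2n (a₃ * conj b) ≢ 0#
      × Trn2n ((a₁ + a₂ + a₃) * conj b) ≢ 0# × h3 b a₁ a₂ a₃ 0# ≡ 0#
  Cond6 b a₁ a₂ a₃ =
    ¬ InU b ×
    ℤ.+ 2 ℤ.* sgn (h3 b a₁ a₂ a₃ 0#)
      ≡ (ℤ.+ 2 ℤ.* sgn (u a₁ * u a₂ + u a₁ * u a₃ + u a₂ * u a₃)
         ℤ.+ sgn (u s) ℤ.* kfun b s)
        ℤ.- ((sgn (u a₁) ℤ.* kfun b a₁ ℤ.+ sgn (u a₂) ℤ.* kfun b a₂)
             ℤ.+ sgn (u a₃) ℤ.* kfun b a₃)
    where
      u = ufun b
      s = a₁ + a₂ + a₃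

{-# OPTIONS --safe #-}
module Submission where

-- All f_i, hence h₃, are constant on the punctured lines x·F_q^*. Such a function g with values ±1 has Walsh
-- coefficients q·g(1/ω) as soon as Σ_{x ≠ 0} g(x) = (q − 1) g(0). Since 2(−1)^{h₃} = Σ (−1)^{f_i} − (−1)^{f_1+f_2+f_3},
-- this condition reduces to evaluating S(b, a) = Σ_{x ≠ 0} (−1)^{Tr(a/(x^{q−1} + b))}. The lines other than F_q are
-- represented by the w with w + conj w = 1. For b ∈ U the sum becomes a linear character sum over these w.
-- For b ∉ U the substitution y = conj x + b x turns it into a sum of Tr(c conj(y)/y), and on the representatives this
-- depends on w² + w only, which leads to the Kloosterman sum.
open import Defs
open import Level using (0ℓ)
open import Algebra.Bundles using (CommutativeRing; RawRing)
open import Algebra.Structures using (IsCommutativeMonoid; IsCommutativeRing)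
open import Algebra.Solver.Ring.AlmostCommutativeRing using (_-Raw-AlmostCommutative⟶_; fromCommutativeRing)
import Algebra.Solver.Ring
open import Data.Bool using (Bool; true; false; _xor_; _∧_)
import Data.Bool.Properties as Bool
open import Data.Empty using (⊥-elim)
import Data.Maybe as Maybe
open import Data.Nat using (ℕ; zero; suc; _>_)
import Data.Nat as ℕ
import Data.Nat.Properties as ℕ
open import Data.Integer as ℤ using (ℤ; 0ℤ; 1ℤ) renaming (_+_ to _⊕_; _*_ to _⊗_; _-_ to _⊖_)
import Data.Integer.Properties as ℤ
import Data.Integer.Solver
open import Data.List using (List; []; _∷_; length; map; filter)
open import Data.List.Relation.Unary.All as All using (All; []; _∷_)
open import Data.List.Relation.Unary.Any as Any using (here; there)
open import Data.List.Relation.Unary.AllPairs using (_∷_)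
open import Data.List.Relation.Unary.Unique.Propositional using (Unique)
import Data.List.Relation.Unary.Unique.Propositional.Properties as Unique
open import Data.List.Membership.Propositional using (_∈_)
open import Data.List.Membership.Propositional.Properties using (∈-map⁺)
open import Data.List.Membership.Propositional.Properties.WithK using (unique∧set⇒bag)
open import Data.List.Relation.Binary.BagAndSetEquality using (∼bag⇒↭)
open import Data.List.Relation.Binary.Permutation.Propositional as Perm using (_↭_)
open import Data.Product using (Σ; ∃; _×_; _,_; proj₁; proj₂)
open import Data.Sum using (_⊎_; inj₁; inj₂)
open import Data.Vec using (Vec; []; _∷_; zipWith)
open import Function using (_∘_; id; mk⇔)
open import Relation.Nullary using (¬_; yes; no)
open import Relation.Nullary.Decidable using (dec⇒maybe)
open import Relation.Binary.PropositionalEquality using (_≡_; _≢_; refl; sym; trans; cong; cong₂; subst; module ≡-Reasoning)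

open ≡-Reasoning
open Data.Integer.Solver.+-*-Solver using ()
  renaming (solve to ℤ-solve; _:+_ to _⟨+⟩_; _:*_ to _⟨*⟩_; _:-_ to _⟨-⟩_; :-_ to ⟨-⟩_; _:=_ to _⟨=⟩_; con to ℤ-con)

-- Write e(x) for the sign of Tr(x). If g is constant on punctured lines, averaging its Walsh sum
-- over the scalings x ↦ vx with v in F_q^* replaces e(ωx) by an indicator of ωx ∈ F_q, up to
-- scaling and a constant. Only the line F_q/ω and the total sum of g survive, and the balance
-- condition fixes the latter. If w + conj w = 1 then w^(q-1) + 1 = 1/w; this is why the exponent
-- becomes linear for b = 1. For b ∈ U the quotient S(b, a)/(q - 1) is 1, with an extra term q or -q
-- exactly when a·conj b ∈ F_q. For b ∉ U it is (-1)^u(a) (1 - k(a)). Each condition makes the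
-- signed sum of the four quotients equal to 2(-1)^h₃(0): in the first five the terms in q cancel or
-- are absent, and the sixth is this equation rewritten. F_q is not a separate type but an indicator
-- weight on the large field, and its characters are restrictions of characters of that field.
-- Integers are never divided: the factors q - 1, 2 and the field order are carried along and
-- cancelled.

-- Finite products in a commutative monoid.

module Aggregate {M : Set} {_∙_ : M → M → M} {ε : M}
                 (isCM : IsCommutativeMonoid _≡_ _∙_ ε) {A : Set} where
  open IsCommutativeMonoid isCM using (identityˡ; identityʳ; assoc; comm)

  agg : List A → (A → M) → M
  agg []       f = ε
  agg (x ∷ xs) f = f x ∙ agg xs f

  agg-cong : ∀ xs {f g} → (∀ x → f x ≡ g x) → agg xs f ≡ agg xs g
  agg-cong []       h = refl
  agg-cong (x ∷ xs) h = cong₂ _∙_ (h x) (agg-cong xs h)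

  interchange : ∀ a b c d → (a ∙ b) ∙ (c ∙ d) ≡ (a ∙ c) ∙ (b ∙ d)
  interchange a b c d = begin
    (a ∙ b) ∙ (c ∙ d)  ≡⟨ assoc a b _ ⟩
    a ∙ (b ∙ (c ∙ d))  ≡⟨ cong (a ∙_) (sym (assoc b c d)) ⟩
    a ∙ ((b ∙ c) ∙ d)  ≡⟨ cong (λ z → a ∙ (z ∙ d)) (comm b c) ⟩
    a ∙ ((c ∙ b) ∙ d)  ≡⟨ cong (a ∙_) (assoc c b d) ⟩
    a ∙ (c ∙ (b ∙ d))  ≡⟨ sym (assoc a c _) ⟩
    (a ∙ c) ∙ (b ∙ d)  ∎

  agg-∙ : ∀ xs f g → agg xs (λ x → f x ∙ g x) ≡ agg xs f ∙ agg xs g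
  agg-∙ []       f g = sym (identityˡ ε)
  agg-∙ (x ∷ xs) f g =
    trans (cong ((f x ∙ g x) ∙_) (agg-∙ xs f g)) (interchange _ _ _ _)

  agg-ε : ∀ xs {f} → All (λ x → f x ≡ ε) xs → agg xs f ≡ ε
  agg-ε []       []       = refl
  agg-ε (x ∷ xs) (p ∷ ps) = trans (cong₂ _∙_ p (agg-ε xs ps)) (identityˡ ε)

  agg-single : ∀ {xs} {f : A → M} {a} → Unique xs → a ∈ xs →
               (∀ x → x ≢ a → f x ≡ ε) → agg xs f ≡ f a
  agg-single {x ∷ xs} (x≢ ∷ u) (here refl) h =
    trans (cong (_ ∙_) (agg-ε xs (All.map (λ ne → h _ (ne ∘ sym)) x≢))) (identityʳ _)
  agg-single {x ∷ xs} (x≢ ∷ u) (there a∈) h =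
    trans (cong₂ _∙_ (h x (All.lookup x≢ a∈)) (agg-single u a∈ h)) (identityˡ _)

  agg-map : ∀ (φ : A → A) xs f → agg (map φ xs) f ≡ agg xs (f ∘ φ)
  agg-map φ []       f = refl
  agg-map φ (x ∷ xs) f = cong (_ ∙_) (agg-map φ xs f)

  agg-↭ : ∀ {xs ys} f → xs ↭ ys → agg xs f ≡ agg ys f
  agg-↭ f Perm.refl         = refl
  agg-↭ f (Perm.prep x p)   = cong (f x ∙_) (agg-↭ f p)
  agg-↭ f (Perm.swap {xs = xs} {ys = ys} x y p) = begin
    f x ∙ (f y ∙ agg xs f)  ≡⟨ sym (assoc _ _ _) ⟩
    (f x ∙ f y) ∙ agg xs f  ≡⟨ cong₂ _∙_ (comm _ _) (agg-↭ f p) ⟩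
    (f y ∙ f x) ∙ agg ys f  ≡⟨ assoc _ _ _ ⟩
    f y ∙ (f x ∙ agg ys f)  ∎
  agg-↭ f (Perm.trans p r)  = trans (agg-↭ f p) (agg-↭ f r)

  -- The list and its image under `φ` both enumerate all of `A` without repetition, so they are
  -- permutations of each other.
  agg-bijection : ∀ {xs} → Unique xs → (∀ x → x ∈ xs) → (φ ψ : A → A) →
                  (∀ x → φ (ψ x) ≡ x) → (∀ x → ψ (φ x) ≡ x) →
                  ∀ f → agg xs (f ∘ φ) ≡ agg xs f
  agg-bijection {xs} u c φ ψ φψ ψφ f = trans (sym (agg-map φ xs f)) (agg-↭ f
    (∼bag⇒↭ (unique∧set⇒bag
      (Unique.map⁺ (λ {x} {y} eq → trans (sym (ψφ x)) (trans (cong ψ eq) (ψφ y))) u) u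
      (λ {x} → mk⇔ (λ _ → c x) (λ _ → subst (_∈ map φ xs) (φψ x) (∈-map⁺ φ (c (ψ x))))))))

-- Arithmetic in characteristic 2, Frobenius powers and Fermat's theorem.

module FieldTheory {m : ℕ} (F : GF2^ m) where
  open GF2^ F
  open IsCommutativeRing isCommutativeRing public
    using (+-assoc; +-comm; +-identityˡ; +-identityʳ; *-assoc; *-comm; *-identityˡ; *-identityʳ
          ; distribˡ; distribʳ; zeroˡ; zeroʳ; *-isCommutativeMonoid)

  emb : Bool → Carrier
  emb false = 0#
  emb true  = 1#

  emb-+ : ∀ x y → emb (x xor y) ≡ emb x + emb y
  emb-+ false y     = sym (+-identityˡ _)
  emb-+ true  false = sym (+-identityʳ _)
  emb-+ true  true  = sym char2

  emb-* : ∀ x y → emb (x ∧ y) ≡ emb x * emb y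
  emb-* false y = sym (zeroˡ _)
  emb-* true  y = sym (*-identityˡ _)

  private
    commutativeRing : CommutativeRing 0ℓ 0ℓ
    commutativeRing = record { isCommutativeRing = isCommutativeRing }

    𝔽₂ : RawRing 0ℓ 0ℓ
    𝔽₂ = record { Carrier = Bool ; _≈_ = _≡_ ; _+_ = _xor_ ; _*_ = _∧_ ; -_ = id ; 0# = false ; 1# = true }

    emb-neg : ∀ x → emb x ≡ - emb x
    emb-neg x = +-cancelˡ (emb x) (emb x) (- emb x) (trans (double x) (sym (CR.-‿inverseʳ (emb x))))
      where
      module CR = CommutativeRing commutativeRing
      open import Algebra.Properties.Group CR.+-group using () renaming (∙-cancelˡ to +-cancelˡ)
      double : ∀ x → emb x + emb x ≡ 0#
      double false = +-identityˡ _
      double true  = char2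

    morphism : 𝔽₂ -Raw-AlmostCommutative⟶ fromCommutativeRing commutativeRing
    morphism = record { ⟦_⟧ = emb ; +-homo = emb-+ ; *-homo = emb-* ; -‿homo = emb-neg
                      ; 0-homo = refl ; 1-homo = refl }

  -- Coefficients are taken in F₂, so the solver knows that x + x = 0.
  module Solver₂ = Algebra.Solver.Ring 𝔽₂ (fromCommutativeRing commutativeRing) morphism
                     (λ x y → Maybe.map (cong emb) (dec⇒maybe (x Bool.≟ y)))
  open Solver₂ using (solve; _:+_; _:*_; _:=_; con)

  x+x≡0 : ∀ x → x + x ≡ 0#
  x+x≡0 = solve 1 (λ x → x :+ x := con false) refl

  x+y≡0⇒x≡y : ∀ {x y} → x + y ≡ 0# → x ≡ y
  x+y≡0⇒x≡y {x} {y} p = begin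
    x            ≡⟨ solve 2 (λ x y → x := (x :+ y) :+ y) refl x y ⟩
    (x + y) + y  ≡⟨ cong (_+ y) p ⟩
    0# + y       ≡⟨ +-identityˡ y ⟩
    y            ∎

  x≡y⇒x+y≡0 : ∀ {x y} → x ≡ y → x + y ≡ 0#
  x≡y⇒x+y≡0 refl = x+x≡0 _

  +-involutive : ∀ x y → (x + y) + y ≡ x
  +-involutive = solve 2 (λ x y → (x :+ y) :+ y := x) refl

  inv-l : ∀ x → x ≢ 0# → inv x * x ≡ 1#
  inv-l x h = trans (*-comm _ _) (inv-r x h)

  *-inv-cancelʳ : ∀ x y → x ≢ 0# → x * (inv x * y) ≡ y
  *-inv-cancelʳ x y h = trans (sym (*-assoc _ _ _)) (trans (cong (_* y) (inv-r x h)) (*-identityˡ y))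

  *-inv-cancelˡ : ∀ x y → x ≢ 0# → inv x * (x * y) ≡ y
  *-inv-cancelˡ x y h = trans (sym (*-assoc _ _ _)) (trans (cong (_* y) (inv-l x h)) (*-identityˡ y))

  *-cancel : ∀ x {y z} → x ≢ 0# → x * y ≡ x * z → y ≡ z
  *-cancel x {y} {z} h p = trans (sym (*-inv-cancelˡ x y h)) (trans (cong (inv x *_) p) (*-inv-cancelˡ x z h))

  x*y≡0 : ∀ {x y} → x * y ≡ 0# → x ≡ 0# ⊎ y ≡ 0#
  x*y≡0 {x} {y} p with x ≟ 0#
  ... | yes z = inj₁ z
  ... | no nz = inj₂ (*-cancel x nz (trans p (sym (zeroʳ x))))

  x*y≢0 : ∀ {x y} → x ≢ 0# → y ≢ 0# → x * y ≢ 0#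
  x*y≢0 h k p with x*y≡0 p
  ... | inj₁ z = h z
  ... | inj₂ z = k z

  x²≡0⇒x≡0 : ∀ {x} → x * x ≡ 0# → x ≡ 0#
  x²≡0⇒x≡0 p with x*y≡0 p
  ... | inj₁ z = z
  ... | inj₂ z = z

  x*y≡1⇒x≢0 : ∀ {x y} → x * y ≡ 1# → x ≢ 0#
  x*y≡1⇒x≢0 p refl = 1≢0 (trans (sym p) (zeroˡ _))

  inv-unique : ∀ {x y} → x * y ≡ 1# → inv x ≡ y
  inv-unique {x} {y} p = *-cancel x nz (trans (inv-r x nz) (sym p))
    where nz = x*y≡1⇒x≢0 p

  inv-≢0 : ∀ {x} → x ≢ 0# → inv x ≢ 0#
  inv-≢0 {x} h = x*y≡1⇒x≢0 (inv-l x h)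

  inv-involutive : ∀ x → inv (inv x) ≡ x
  inv-involutive x with x ≟ 0#
  ... | yes refl = trans (cong inv inv-0) inv-0
  ... | no h = inv-unique (inv-l x h)

  inv-1 : inv 1# ≡ 1#
  inv-1 = inv-unique (*-identityˡ 1#)

  inv-* : ∀ x y → inv (x * y) ≡ inv x * inv y
  inv-* x y with x ≟ 0# | y ≟ 0#
  ... | yes refl | _ = trans (cong inv (zeroˡ y)) (trans inv-0 (sym (trans (cong (_* inv y) inv-0) (zeroˡ _))))
  ... | no _ | yes refl = trans (cong inv (zeroʳ x)) (trans inv-0 (sym (trans (cong (inv x *_) inv-0) (zeroʳ _))))
  ... | no h | no k = inv-unique (begin
    (x * y) * (inv x * inv y)  ≡⟨ solve 4 (λ x y z w → (x :* y) :* (z :* w) := (x :* z) :* (y :* w)) refl x y (inv x) (inv y) ⟩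
    (x * inv x) * (y * inv y)  ≡⟨ cong₂ _*_ (inv-r x h) (inv-r y k) ⟩
    1# * 1#                    ≡⟨ *-identityˡ 1# ⟩
    1#                         ∎)

  Bit : Carrier → Set
  Bit t = t ≡ 0# ⊎ t ≡ 1#

  idempotent⇒Bit : ∀ {t} → t * t + t ≡ 0# → Bit t
  idempotent⇒Bit {t} p with x*y≡0 {t} {t + 1#} (trans (solve 1 (λ t → t :* (t :+ con true) := t :* t :+ t) refl t) p)
  ... | inj₁ z = inj₁ z
  ... | inj₂ z = inj₂ (x+y≡0⇒x≡y z)

  ^-+ : ∀ x i j → x ^ (i ℕ.+ j) ≡ (x ^ i) * (x ^ j)
  ^-+ x zero    j = sym (*-identityˡ _)
  ^-+ x (suc i) j = trans (cong (x *_) (^-+ x i j)) (sym (*-assoc _ _ _))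

  *-^ : ∀ x y i → (x * y) ^ i ≡ (x ^ i) * (y ^ i)
  *-^ x y zero    = sym (*-identityˡ _)
  *-^ x y (suc i) = trans (cong ((x * y) *_) (*-^ x y i))
    (solve 4 (λ x y z w → (x :* y) :* (z :* w) := (x :* z) :* (y :* w)) refl x y (x ^ i) (y ^ i))

  1^ : ∀ i → 1# ^ i ≡ 1#
  1^ zero    = refl
  1^ (suc i) = trans (*-identityˡ _) (1^ i)

  ^-* : ∀ x i j → x ^ (i ℕ.* j) ≡ (x ^ i) ^ j
  ^-* x zero    j = sym (1^ j)
  ^-* x (suc i) j = trans (^-+ x j (i ℕ.* j)) (trans (cong ((x ^ j) *_) (^-* x i j)) (sym (*-^ x (x ^ i) j)))

  x^2 : ∀ x → x ^ 2 ≡ x * x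
  x^2 x = cong (x *_) (*-identityʳ x)

  frob : ℕ → Carrier → Carrier
  frob k x = x ^ (2 ℕ.^ k)

  frob-suc : ∀ k x → frob (suc k) x ≡ frob k x * frob k x
  frob-suc k x = trans (cong (x ^_) (ℕ.*-comm 2 (2 ℕ.^ k))) (trans (^-* x (2 ℕ.^ k) 2) (x^2 _))

  frob-0 : ∀ x → frob 0 x ≡ x
  frob-0 = *-identityʳ

  frob-+ : ∀ k x y → frob k (x + y) ≡ frob k x + frob k y
  frob-+ zero    x y = trans (frob-0 _) (sym (cong₂ _+_ (frob-0 x) (frob-0 y)))
  frob-+ (suc k) x y = begin
    frob (suc k) (x + y)                               ≡⟨ frob-suc k _ ⟩
    frob k (x + y) * frob k (x + y)                    ≡⟨ cong (λ z → z * z) (frob-+ k x y) ⟩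
    (frob k x + frob k y) * (frob k x + frob k y)      ≡⟨ solve 2 (λ x y → (x :+ y) :* (x :+ y) := x :* x :+ y :* y) refl _ _ ⟩
    frob k x * frob k x + frob k y * frob k y          ≡⟨ sym (cong₂ _+_ (frob-suc k x) (frob-suc k y)) ⟩
    frob (suc k) x + frob (suc k) y                    ∎

  frob-∘ : ∀ i j x → frob (i ℕ.+ j) x ≡ frob i (frob j x)
  frob-∘ i j x = trans (cong (x ^_) (trans (ℕ.^-distribˡ-+-* 2 i j) (ℕ.*-comm (2 ℕ.^ i) (2 ℕ.^ j)))) (^-* x (2 ℕ.^ j) (2 ℕ.^ i))

  0^ : ∀ k → .{{ℕ.NonZero k}} → 0# ^ k ≡ 0#
  0^ (suc k) = zeroˡ _

  frob-zero : ∀ k → frob k 0# ≡ 0#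
  frob-zero k = 0^ (2 ℕ.^ k) {{ℕ.m^n≢0 2 k}}

  -- Multiplication by x ≠ 0 permutes the nonzero elements; compare their products.
  private
    module Π = Aggregate *-isCommutativeMonoid {Carrier}

    Π-const : ∀ (xs : List Carrier) x → Π.agg xs (λ _ → x) ≡ x ^ length xs
    Π-const []       x = refl
    Π-const (_ ∷ xs) x = cong (x *_) (Π-const xs x)

    Π-≢0 : ∀ (xs : List Carrier) f → (∀ x → f x ≢ 0#) → Π.agg xs f ≢ 0#
    Π-≢0 []       f h = 1≢0
    Π-≢0 (x ∷ xs) f h = x*y≢0 (h x) (Π-≢0 xs f h)

    -- Replacing 0 by 1 makes the product over the whole list equal to the product of the nonzero
    -- elements.
    unit : Carrier → Carrier
    unit y with y ≟ 0#
    ... | yes _ = 1#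
    ... | no  _ = y

    unit-≢0 : ∀ y → unit y ≢ 0#
    unit-≢0 y with y ≟ 0#
    ... | yes _ = 1≢0
    ... | no h = h

    -- The constant x is split so that `scale` gathers the 2^m - 1 factors at nonzero places, whose
    -- product is 1, while `atZero` keeps the single factor left over. This gives x^(2^m) = x with
    -- no predecessor of 2^m.
    scale atZero : Carrier → Carrier → Carrier
    scale x y with y ≟ 0#
    ... | yes _ = 1#
    ... | no  _ = x
    atZero x y with y ≟ 0#
    ... | yes _ = x
    ... | no  _ = 1#

    atZero-0 : ∀ x → atZero x 0# ≡ x
    atZero-0 x with 0# ≟ 0#
    ... | yes _ = refl
    ... | no h = ⊥-elim (h refl)

    atZero-≢ : ∀ x y → y ≢ 0# → atZero x y ≡ 1#
    atZero-≢ x y h with y ≟ 0#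
    ... | yes z = ⊥-elim (h z)
    ... | no _ = refl

    scale*atZero : ∀ x y → scale x y * atZero x y ≡ x
    scale*atZero x y with y ≟ 0#
    ... | yes _ = *-identityˡ x
    ... | no  _ = *-identityʳ x

    unit-scale : ∀ x → x ≢ 0# → ∀ y → unit (x * y) ≡ scale x y * unit y
    unit-scale x h y with y ≟ 0# | (x * y) ≟ 0#
    ... | yes _    | yes _ = sym (*-identityˡ 1#)
    ... | yes refl | no k  = ⊥-elim (k (zeroʳ x))
    ... | no k     | yes z = ⊥-elim (x*y≢0 h k z)
    ... | no _     | no _  = refl

    Π-scale : ∀ x → x ≢ 0# → Π.agg elems (scale x) ≡ 1#
    Π-scale x h = *-cancel P (Π-≢0 elems unit unit-≢0) (begin
      P * Π.agg elems (scale x)                 ≡⟨ *-comm _ _ ⟩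
      Π.agg elems (scale x) * P                 ≡⟨ sym (Π.agg-∙ elems (scale x) unit) ⟩
      Π.agg elems (λ y → scale x y * unit y)    ≡⟨ sym (Π.agg-cong elems (unit-scale x h)) ⟩
      Π.agg elems (λ y → unit (x * y))          ≡⟨ Π.agg-bijection elems-unique elems-complete (x *_) (inv x *_)
                                                     (λ y → *-inv-cancelʳ x y h) (λ y → *-inv-cancelˡ x y h) unit ⟩
      P                                         ≡⟨ sym (*-identityʳ P) ⟩
      P * 1#                                    ∎)
      where P = Π.agg elems unit

  fermat : ∀ x → frob m x ≡ x
  fermat x with x ≟ 0#
  ... | yes refl = frob-zero m
  ... | no h = begin
    x ^ (2 ℕ.^ m)                                       ≡⟨ cong (x ^_) (sym elems-card) ⟩
    x ^ length elems                                    ≡⟨ sym (Π-const elems x) ⟩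
    Π.agg elems (λ _ → x)                               ≡⟨ sym (Π.agg-cong elems (scale*atZero x)) ⟩
    Π.agg elems (λ y → scale x y * atZero x y)          ≡⟨ Π.agg-∙ elems (scale x) (atZero x) ⟩
    Π.agg elems (scale x) * Π.agg elems (atZero x)      ≡⟨ cong₂ _*_ (Π-scale x h)
                                                             (Π.agg-single elems-unique (elems-complete 0#) (atZero-≢ x)) ⟩
    1# * atZero x 0#                                    ≡⟨ trans (*-identityˡ _) (atZero-0 x) ⟩
    x                                                   ∎

-- Integer sums over the field, indicators and signs.

x≡-x⇒x≡0 : ∀ x → x ≡ ℤ.- x → x ≡ 0ℤ
x≡-x⇒x≡0 (ℤ.+ zero)  p = refl
x≡-x⇒x≡0 (ℤ.+ suc _) ()
x≡-x⇒x≡0 (ℤ.-[1+ _ ]) ()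

±1-square : ∀ x → x ≡ 1ℤ ⊎ x ≡ ℤ.- 1ℤ → x ⊗ x ≡ 1ℤ
±1-square x (inj₁ refl) = refl
±1-square x (inj₂ refl) = refl

module Sums {m : ℕ} (F : GF2^ m) where
  open GF2^ F
  open FieldTheory F
  private module Σᴬ = Aggregate ℤ.+-0-isCommutativeMonoid {Carrier}

  P : ℤ
  P = ℤ.+ (2 ℕ.^ m)

  ∑ : (Carrier → ℤ) → ℤ
  ∑ = Σℤ elems

  syntax ∑ (λ x → t) = ∑[ x ] t
  infix 9 ∑

  private
    Σℤ-agg : ∀ xs f → Σℤ xs f ≡ Σᴬ.agg xs f
    Σℤ-agg []       f = refl
    Σℤ-agg (x ∷ xs) f = cong (f x ⊕_) (Σℤ-agg xs f)

    Σℤ-const : ∀ (xs : List Carrier) → Σℤ xs (λ _ → 1ℤ) ≡ ℤ.+ length xs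
    Σℤ-const []       = refl
    Σℤ-const (x ∷ xs) = cong (1ℤ ⊕_) (Σℤ-const xs)

    Σℤ-0 : ∀ (xs : List Carrier) → Σℤ xs (λ _ → 0ℤ) ≡ 0ℤ
    Σℤ-0 []       = refl
    Σℤ-0 (x ∷ xs) = trans (ℤ.+-identityˡ _) (Σℤ-0 xs)

    Σℤ-*ˡ : ∀ xs c f → Σℤ xs (λ x → c ⊗ f x) ≡ c ⊗ Σℤ xs f
    Σℤ-*ˡ []       c f = sym (ℤ.*-zeroʳ c)
    Σℤ-*ˡ (x ∷ xs) c f = trans (cong (c ⊗ f x ⊕_) (Σℤ-*ˡ xs c f)) (sym (ℤ.*-distribˡ-+ c (f x) _))

    Σℤ-+ : ∀ xs f g → Σℤ xs (λ x → f x ⊕ g x) ≡ Σℤ xs f ⊕ Σℤ xs g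
    Σℤ-+ xs f g = trans (Σℤ-agg xs _) (trans (Σᴬ.agg-∙ xs f g) (sym (cong₂ _⊕_ (Σℤ-agg xs f) (Σℤ-agg xs g))))

    Σℤ-swap : ∀ xs ys (f : Carrier → Carrier → ℤ) →
              Σℤ xs (λ x → Σℤ ys (f x)) ≡ Σℤ ys (λ y → Σℤ xs (λ x → f x y))
    Σℤ-swap []       ys f = sym (Σℤ-0 ys)
    Σℤ-swap (x ∷ xs) ys f = trans (cong (Σℤ ys (f x) ⊕_) (Σℤ-swap xs ys f)) (sym (Σℤ-+ ys (f x) _))

  ∑-cong : ∀ {f g} → (∀ x → f x ≡ g x) → ∑ f ≡ ∑ g
  ∑-cong h = trans (Σℤ-agg elems _) (trans (Σᴬ.agg-cong elems h) (sym (Σℤ-agg elems _)))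

  ∑-+ : ∀ f g → ∑[ x ] (f x ⊕ g x) ≡ ∑ f ⊕ ∑ g
  ∑-+ = Σℤ-+ elems

  ∑-*ˡ : ∀ c f → ∑[ x ] (c ⊗ f x) ≡ c ⊗ ∑ f
  ∑-*ˡ = Σℤ-*ˡ elems

  ∑-*ʳ : ∀ f c → ∑[ x ] (f x ⊗ c) ≡ ∑ f ⊗ c
  ∑-*ʳ f c = trans (∑-cong (λ x → ℤ.*-comm (f x) c)) (trans (∑-*ˡ c f) (ℤ.*-comm c _))

  ∑-neg : ∀ f → ∑[ x ] (ℤ.- f x) ≡ ℤ.- ∑ f
  ∑-neg f = trans (∑-cong (λ x → sym (ℤ.-1*i≡-i (f x)))) (trans (∑-*ˡ (ℤ.- 1ℤ) f) (ℤ.-1*i≡-i (∑ f)))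

  ∑-- : ∀ f g → ∑[ x ] (f x ⊖ g x) ≡ ∑ f ⊖ ∑ g
  ∑-- f g = trans (∑-+ f (λ x → ℤ.- g x)) (cong (∑ f ⊕_) (∑-neg g))

  ∑-swap : ∀ (f : Carrier → Carrier → ℤ) → ∑[ x ] (∑[ y ] f x y) ≡ ∑[ y ] (∑[ x ] f x y)
  ∑-swap = Σℤ-swap elems elems

  ∑-1 : ∑[ x ] 1ℤ ≡ P
  ∑-1 = trans (Σℤ-const elems) (cong ℤ.+_ elems-card)

  ∑-bijection : ∀ (φ ψ : Carrier → Carrier) → (∀ x → φ (ψ x) ≡ x) → (∀ x → ψ (φ x) ≡ x) →
                ∀ f → ∑ f ≡ ∑[ x ] f (φ x)
  ∑-bijection φ ψ p r f = sym (trans (Σℤ-agg elems _)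
    (trans (Σᴬ.agg-bijection elems-unique elems-complete φ ψ p r f) (sym (Σℤ-agg elems f))))

  ∑-translate : ∀ a f → ∑ f ≡ ∑[ x ] f (x + a)
  ∑-translate a = ∑-bijection (_+ a) (_+ a) (λ x → +-involutive x a) (λ x → +-involutive x a)

  ∑-scale : ∀ a → a ≢ 0# → ∀ f → ∑ f ≡ ∑[ x ] f (a * x)
  ∑-scale a h = ∑-bijection (a *_) (inv a *_) (λ x → *-inv-cancelʳ a x h) (λ x → *-inv-cancelˡ a x h)

  ∑-inv : ∀ f → ∑ f ≡ ∑[ x ] f (inv x)
  ∑-inv = ∑-bijection inv inv inv-involutive inv-involutive

  -- Restricted sums are written as sums over the whole field weighted by indicators, so that
  -- exchange of sums and substitution are required only for the full list.
  δ : Carrier → Carrier → ℤ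
  δ x y with x ≟ y
  ... | yes _ = 1ℤ
  ... | no  _ = 0ℤ

  δ-≡ : ∀ {x y} → x ≡ y → δ x y ≡ 1ℤ
  δ-≡ {x} {y} p with x ≟ y
  ... | yes _ = refl
  ... | no h = ⊥-elim (h p)

  δ-≢ : ∀ {x y} → x ≢ y → δ x y ≡ 0ℤ
  δ-≢ {x} {y} h with x ≟ y
  ... | yes p = ⊥-elim (h p)
  ... | no _ = refl

  δ-⇔ : ∀ {x y z w} → (x ≡ y → z ≡ w) → (z ≡ w → x ≡ y) → δ x y ≡ δ z w
  δ-⇔ {x} {y} {z} {w} f g with x ≟ y
  ... | yes p = sym (δ-≡ (f p))
  ... | no h  = sym (δ-≢ (h ∘ g))

  δ-cong : ∀ {x y u v} → (x ≡ y → u ≡ v) → δ x y ⊗ u ≡ δ x y ⊗ v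
  δ-cong {x} {y} f with x ≟ y
  ... | yes p = cong (1ℤ ⊗_) (f p)
  ... | no _  = refl

  ∑-δ : ∀ a (f : Carrier → ℤ) → ∑[ x ] (δ x a ⊗ f x) ≡ f a
  ∑-δ a f = begin
    ∑[ x ] (δ x a ⊗ f x)                 ≡⟨ Σℤ-agg elems _ ⟩
    Σᴬ.agg elems (λ x → δ x a ⊗ f x)     ≡⟨ Σᴬ.agg-single elems-unique (elems-complete a)
                                              (λ x h → trans (cong (_⊗ f x) (δ-≢ h)) (ℤ.*-zeroˡ (f x))) ⟩
    δ a a ⊗ f a                          ≡⟨ cong (_⊗ f a) (δ-≡ refl) ⟩
    1ℤ ⊗ f a                             ≡⟨ ℤ.*-identityˡ _ ⟩
    f a                                  ∎

  ν : Carrier → ℤ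
  ν x = 1ℤ ⊖ δ x 0#

  ν-0 : ∀ {x} → x ≡ 0# → ν x ≡ 0ℤ
  ν-0 p = cong (1ℤ ⊖_) (δ-≡ p)

  ν-cong : ∀ {x u v} → (x ≢ 0# → u ≡ v) → ν x ⊗ u ≡ ν x ⊗ v
  ν-cong {x} f with x ≟ 0#
  ... | yes p = refl
  ... | no h  = cong (1ℤ ⊗_) (f h)

  ∑-ν : ∀ f → ∑ f ≡ f 0# ⊕ ∑[ x ] (ν x ⊗ f x)
  ∑-ν f = begin
    ∑ f                                             ≡⟨ ∑-cong (λ x → ℤ-solve 2 (λ d y → y ⟨=⟩ d ⟨*⟩ y ⟨+⟩ (ℤ-con 1ℤ ⟨-⟩ d) ⟨*⟩ y) refl (δ x 0#) (f x)) ⟩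
    ∑[ x ] (δ x 0# ⊗ f x ⊕ ν x ⊗ f x)               ≡⟨ ∑-+ _ _ ⟩
    (∑[ x ] (δ x 0# ⊗ f x)) ⊕ ∑[ x ] (ν x ⊗ f x)      ≡⟨ cong (_⊕ ∑[ x ] (ν x ⊗ f x)) (∑-δ 0# f) ⟩
    f 0# ⊕ ∑[ x ] (ν x ⊗ f x)                       ∎

  Σℤ-filter : ∀ (φ ψ : Carrier → Carrier) f → Σℤ (filter (λ x → φ x ≟ ψ x) elems) f ≡ ∑[ x ] (δ (φ x) (ψ x) ⊗ f x)
  Σℤ-filter φ ψ f = go elems
    where
    go : ∀ xs → Σℤ (filter (λ x → φ x ≟ ψ x) xs) f ≡ Σℤ xs (λ x → δ (φ x) (ψ x) ⊗ f x)
    go []       = refl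
    go (x ∷ xs) with φ x ≟ ψ x
    ... | yes _ = cong₂ _⊕_ (sym (ℤ.*-identityˡ (f x))) (go xs)
    ... | no  _ = trans (go xs) (sym (ℤ.+-identityˡ _))

  sgn-0 : sgn 0# ≡ 1ℤ
  sgn-0 with 0# ≟ 0#
  ... | yes _ = refl
  ... | no h = ⊥-elim (h refl)

  sgn-1 : sgn 1# ≡ ℤ.- 1ℤ
  sgn-1 with 1# ≟ 0#
  ... | yes p = ⊥-elim (1≢0 p)
  ... | no _ = refl

  sgn-± : ∀ t → sgn t ≡ 1ℤ ⊎ sgn t ≡ ℤ.- 1ℤ
  sgn-± t with t ≟ 0#
  ... | yes _ = inj₁ refl
  ... | no _ = inj₂ refl

  sgn-² : ∀ t → sgn t ⊗ sgn t ≡ 1ℤ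
  sgn-² t = ±1-square (sgn t) (sgn-± t)

  sgn-+ : ∀ {s t} → Bit s → Bit t → sgn (s + t) ≡ sgn s ⊗ sgn t
  sgn-+ {t = t} (inj₁ refl) _ = trans (cong sgn (+-identityˡ t)) (sym (trans (cong (_⊗ sgn t) sgn-0) (ℤ.*-identityˡ _)))
  sgn-+ {s} _ (inj₁ refl) = trans (cong sgn (+-identityʳ s)) (sym (trans (cong (sgn s ⊗_) sgn-0) (ℤ.*-identityʳ _)))
  sgn-+ (inj₂ refl) (inj₂ refl) = trans (cong sgn char2) (trans sgn-0 (sym (cong₂ _⊗_ sgn-1 sgn-1)))

-- Polynomials and the bound on their number of roots.

module Polynomials {m : ℕ} (F : GF2^ m) where
  open GF2^ F
  open FieldTheory F
  open Solver₂ using (solve; _:+_; _:*_; _:=_; con)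

  -- A coefficient vector of length d denotes a polynomial of degree < d ...
  below : ∀ {d} → Vec Carrier d → Carrier → Carrier
  below []       x = 0#
  below (c ∷ cs) x = c + x * below cs x

  -- ... or, with an added leading term x^d, a monic polynomial of degree d.
  monic : ∀ {d} → Vec Carrier d → Carrier → Carrier
  monic []       x = 1#
  monic (c ∷ cs) x = c + x * monic cs x

  monic-below : ∀ {d} (cs : Vec Carrier d) x → monic cs x ≡ (x ^ d) + below cs x
  monic-below []       x = sym (+-identityʳ _)
  monic-below {suc d} (c ∷ cs) x = trans (cong (λ z → c + x * z) (monic-below cs x))
    (solve 4 (λ c x p b → c :+ x :* (p :+ b) := x :* p :+ (c :+ x :* b)) refl c x (x ^ d) (below cs x))

  -- Synthetic division by X + r: the coefficients of the quotient are the intermediate values of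
  -- Horner's scheme at r.
  quotient : ∀ {d} → Vec Carrier (suc d) → Carrier → Vec Carrier d
  quotient (c ∷ [])      r = []
  quotient (c ∷ c′ ∷ cs) r = monic (c′ ∷ cs) r ∷ quotient (c′ ∷ cs) r

  monic-quotient : ∀ {d} (cs : Vec Carrier (suc d)) r x →
                   monic cs x + monic cs r ≡ (x + r) * monic (quotient cs r) x
  monic-quotient (c ∷ []) r x =
    solve 3 (λ c r x → (c :+ x :* con true) :+ (c :+ r :* con true) := (x :+ r) :* con true) refl c r x
  monic-quotient (c ∷ p@(_ ∷ _)) r x = begin
    (c + x * monic p x) + (c + r * monic p r)
      ≡⟨ solve 5 (λ c x r a b → (c :+ x :* a) :+ (c :+ r :* b) := x :* (a :+ b) :+ (x :+ r) :* b) refl c x r (monic p x) (monic p r) ⟩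
    x * (monic p x + monic p r) + (x + r) * monic p r
      ≡⟨ cong (λ z → x * z + (x + r) * monic p r) (monic-quotient p r x) ⟩
    x * ((x + r) * monic (quotient p r) x) + (x + r) * monic p r
      ≡⟨ solve 4 (λ x r g b → x :* ((x :+ r) :* g) :+ (x :+ r) :* b := (x :+ r) :* (b :+ x :* g)) refl x r _ _ ⟩
    (x + r) * (monic p r + x * monic (quotient p r) x) ∎

  -- A root r splits off the factor X + r. Every other root differs from r, so in a field it must be
  -- a root of the quotient, which has degree one less.
  roots≤degree : ∀ {d} (cs : Vec Carrier d) {xs} → Unique xs → All (λ x → monic cs x ≡ 0#) xs → length xs ℕ.≤ d
  roots≤degree cs       {[]}     _        _        = ℕ.z≤n
  roots≤degree []       {r ∷ xs} _        (p ∷ _)  = ⊥-elim (1≢0 p)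
  roots≤degree cs@(_ ∷ _) {r ∷ xs} (r≢ ∷ u) (p ∷ ps) = ℕ.s≤s (roots≤degree (quotient cs r) u (go r≢ ps))
    where
    go : ∀ {ys} → All (r ≢_) ys → All (λ x → monic cs x ≡ 0#) ys → All (λ x → monic (quotient cs r) x ≡ 0#) ys
    go []       []       = []
    go {x ∷ _} (h ∷ hs) (e ∷ es) with x*y≡0 (trans (sym (monic-quotient cs r x)) (trans (cong₂ _+_ e p) (+-identityˡ 0#)))
    ... | inj₁ z = ⊥-elim (h (sym (x+y≡0⇒x≡y z)))
    ... | inj₂ z = z ∷ go hs es

  Below : ℕ → (Carrier → Carrier) → Set
  Below d f = Σ (Vec Carrier d) λ cs → ∀ x → below cs x ≡ f x

  Below-0 : ∀ d → Below d (λ _ → 0#)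
  Below-0 zero    = [] , λ _ → refl
  Below-0 (suc d) with Below-0 d
  ... | cs , p = 0# ∷ cs , λ x → trans (cong (λ z → 0# + x * z) (p x)) (trans (+-identityˡ _) (zeroʳ x))

  below-zipWith : ∀ {d} (cs ds : Vec Carrier d) x → below (zipWith _+_ cs ds) x ≡ below cs x + below ds x
  below-zipWith []       []       x = sym (+-identityˡ _)
  below-zipWith (c ∷ cs) (d ∷ ds) x = trans (cong (λ z → (c + d) + x * z) (below-zipWith cs ds x))
    (solve 5 (λ c d x a b → (c :+ d) :+ x :* (a :+ b) := (c :+ x :* a) :+ (d :+ x :* b)) refl c d x (below cs x) (below ds x))

  Below-+ : ∀ {d f g} → Below d f → Below d g → Below d (λ x → f x + g x)
  Below-+ (cs , p) (ds , r) = zipWith _+_ cs ds , λ x → trans (below-zipWith cs ds x) (cong₂ _+_ (p x) (r x))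

  Below-^ : ∀ {d i} → i ℕ.< d → Below d (_^ i)
  Below-^ {suc d} {zero} _ with Below-0 d
  ... | cs , p = 1# ∷ cs , λ x → trans (cong (λ z → 1# + x * z) (p x)) (trans (cong (1# +_) (zeroʳ x)) (+-identityʳ 1#))
  Below-^ {suc d} {suc i} (ℕ.s≤s h) with Below-^ h
  ... | cs , p = 0# ∷ cs , λ x → trans (+-identityˡ _) (cong (x *_) (p x))

  traceSum-Below : ∀ k {d} → 2 ℕ.^ k ℕ.≤ d → Below d (traceSum 1 k)
  traceSum-Below zero    {d} h = Below-0 d
  traceSum-Below (suc k) {d} h = Below-+ (Below-^ (ℕ.<-≤-trans lt h)) (traceSum-Below k (ℕ.≤-trans (ℕ.^-monoʳ-≤ 2 (ℕ.n≤1+n k)) h))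
    where
    lt : 2 ℕ.^ (k ℕ.* 1) ℕ.< 2 ℕ.^ suc k
    lt = subst (λ i → 2 ℕ.^ i ℕ.< 2 ℕ.^ suc k) (sym (ℕ.*-identityʳ k)) (ℕ.^-monoʳ-< 2 (ℕ.s≤s (ℕ.s≤s ℕ.z≤n)) (ℕ.n<1+n k))

  traceSum-monic : ∀ k → Σ (Vec Carrier (2 ℕ.^ k)) λ cs → ∀ x → monic cs x ≡ traceSum 1 (suc k) x
  traceSum-monic k with traceSum-Below k ℕ.≤-refl
  ... | cs , p = cs , λ x → trans (monic-below cs x) (cong₂ _+_ (cong (λ i → x ^ (2 ℕ.^ i)) (sym (ℕ.*-identityʳ k))) (p x))

-- Partial trace sums.

module Traces {m : ℕ} (F : GF2^ m) where
  open GF2^ F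
  open FieldTheory F
  open Solver₂ using (solve; _:+_; _:*_; _:=_; con)

  T : ℕ → Carrier → Carrier
  T = traceSum 1

  T-suc : ∀ k x → T (suc k) x ≡ frob k x + T k x
  T-suc k x = cong (λ i → frob i x + T k x) (ℕ.*-identityʳ k)

  T-+ : ∀ k x y → T k (x + y) ≡ T k x + T k y
  T-+ zero    x y = sym (+-identityˡ _)
  T-+ (suc k) x y = begin
    T (suc k) (x + y)                              ≡⟨ T-suc k _ ⟩
    frob k (x + y) + T k (x + y)                   ≡⟨ cong₂ _+_ (frob-+ k x y) (T-+ k x y) ⟩
    (frob k x + frob k y) + (T k x + T k y)        ≡⟨ solve 4 (λ a b c d → (a :+ b) :+ (c :+ d) := (a :+ c) :+ (b :+ d)) refl _ _ _ _ ⟩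
    (frob k x + T k x) + (frob k y + T k y)        ≡⟨ sym (cong₂ _+_ (T-suc k x) (T-suc k y)) ⟩
    T (suc k) x + T (suc k) y                      ∎

  T-0 : ∀ k → T k 0# ≡ 0#
  T-0 k = begin
    T k 0#            ≡⟨ cong (T k) (sym (+-identityˡ 0#)) ⟩
    T k (0# + 0#)     ≡⟨ T-+ k 0# 0# ⟩
    T k 0# + T k 0#   ≡⟨ x+x≡0 _ ⟩
    0#                ∎

  T-sq : ∀ k x → T k (x * x) ≡ T k x * T k x
  T-sq zero    x = sym (zeroˡ _)
  T-sq (suc k) x = begin
    T (suc k) (x * x)                              ≡⟨ T-suc k _ ⟩
    frob k (x * x) + T k (x * x)                   ≡⟨ cong₂ _+_ (*-^ x x (2 ℕ.^ k)) (T-sq k x) ⟩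
    frob k x * frob k x + T k x * T k x            ≡⟨ solve 2 (λ a b → a :* a :+ b :* b := (a :+ b) :* (a :+ b)) refl _ _ ⟩
    (frob k x + T k x) * (frob k x + T k x)        ≡⟨ sym (cong (λ z → z * z) (T-suc k x)) ⟩
    T (suc k) x * T (suc k) x                      ∎

  -- Squaring moves each term x^(2^i) to the next one, so the sum of both expressions telescopes to
  -- its two ends.
  T-artinSchreier : ∀ k x → T k x * T k x + T k x ≡ frob k x + x
  T-artinSchreier zero    x = trans (trans (+-identityʳ _) (zeroˡ _)) (sym (x≡y⇒x+y≡0 (frob-0 x)))
  T-artinSchreier (suc k) x = begin
    T (suc k) x * T (suc k) x + T (suc k) x
      ≡⟨ cong (λ z → z * z + z) (T-suc k x) ⟩
    (a + t) * (a + t) + (a + t)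
      ≡⟨ solve 2 (λ a t → (a :+ t) :* (a :+ t) :+ (a :+ t) := (a :* a :+ a) :+ (t :* t :+ t)) refl a t ⟩
    (a * a + a) + (t * t + t)
      ≡⟨ cong ((a * a + a) +_) (T-artinSchreier k x) ⟩
    (a * a + a) + (a + x)
      ≡⟨ solve 2 (λ a x → (a :* a :+ a) :+ (a :+ x) := a :* a :+ x) refl a x ⟩
    a * a + x
      ≡⟨ cong (_+ x) (sym (frob-suc k x)) ⟩
    frob (suc k) x + x ∎
    where
    a = frob k x
    t = T k x

  -- For k = n the right side is the relative trace of x. This ties the value of Tr_n at w² + w to
  -- the fibre of `τ` in which w lies.
  T-wp : ∀ k x → T k (x * x + x) ≡ frob k x + x
  T-wp k x = trans (T-+ k (x * x) x) (trans (cong (_+ T k x) (T-sq k x)) (T-artinSchreier k x))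

  T-Bit : ∀ k {x} → frob k x ≡ x → Bit (T k x)
  T-Bit k {x} p = idempotent⇒Bit (trans (T-artinSchreier k x) (x≡y⇒x+y≡0 p))

  -- For i = j = n this is transitivity of the trace along F_2 ⊂ F_q ⊂ F_(q²).
  T-split : ∀ i j x → T (i ℕ.+ j) x ≡ T i (frob j x) + T j x
  T-split zero    j x = sym (+-identityˡ _)
  T-split (suc i) j x = begin
    T (suc (i ℕ.+ j)) x                                   ≡⟨ T-suc (i ℕ.+ j) x ⟩
    frob (i ℕ.+ j) x + T (i ℕ.+ j) x                      ≡⟨ cong₂ _+_ (frob-∘ i j x) (T-split i j x) ⟩
    frob i (frob j x) + (T i (frob j x) + T j x)          ≡⟨ sym (+-assoc _ _ _) ⟩
    (frob i (frob j x) + T i (frob j x)) + T j x          ≡⟨ cong (_+ T j x) (sym (T-suc i (frob j x))) ⟩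
    T (suc i) (frob j x) + T j x                          ∎

-- The additive character and the Artin-Schreier equation.

module Characters {m : ℕ} (F : GF2^ (suc m)) where
  open GF2^ F
  open FieldTheory F
  open Solver₂ using (solve; _:+_; _:*_; _:=_; con)
  open Sums F
  open Polynomials F
  open Traces F

  Tr : Carrier → Carrier
  Tr = T (suc m)

  Tr-Bit : ∀ x → Bit (Tr x)
  Tr-Bit x = T-Bit (suc m) (fermat x)

  -- The trace is a monic polynomial of degree 2^m, which is less than the
  -- number of elements of the field.
  Tr-nontrivial : ∃ λ t → Tr t ≡ 1#
  Tr-nontrivial with Any.any? (λ t → Tr t ≟ 1#) elems
  ... | yes p = Any.satisfied p
  ... | no h  = ⊥-elim (ℕ.<⇒≱ (ℕ.^-monoʳ-< 2 (ℕ.s≤s (ℕ.s≤s ℕ.z≤n)) (ℕ.n<1+n m))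
                 (subst (ℕ._≤ 2 ℕ.^ m) elems-card (roots≤degree cs elems-unique (All.tabulate isRoot))))
    where
    cs = proj₁ (traceSum-monic m)
    isRoot : ∀ {x} → x ∈ elems → monic cs x ≡ 0#
    isRoot {x} x∈ with Tr-Bit x
    ... | inj₁ z = trans (proj₂ (traceSum-monic m) x) z
    ... | inj₂ o = ⊥-elim (h (Any.map (λ { refl → o }) x∈))

  e : Carrier → ℤ
  e x = sgn (Tr x)

  e-+ : ∀ x y → e (x + y) ≡ e x ⊗ e y
  e-+ x y = trans (cong sgn (T-+ (suc m) x y)) (sgn-+ (Tr-Bit x) (Tr-Bit y))

  e-0 : e 0# ≡ 1ℤ
  e-0 = trans (cong sgn (T-0 (suc m))) sgn-0

  Bit-idem : ∀ {t} → Bit t → t * t ≡ t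
  Bit-idem (inj₁ refl) = zeroˡ _
  Bit-idem (inj₂ refl) = *-identityˡ _

  e-sq : ∀ x → e (x * x) ≡ e x
  e-sq x = cong sgn (trans (T-sq (suc m) x) (Bit-idem (Tr-Bit x)))

  e-frob : ∀ k x → e (frob k x) ≡ e x
  e-frob zero    x = cong e (frob-0 x)
  e-frob (suc k) x = trans (cong e (frob-suc k x)) (trans (e-sq _) (e-frob k x))

  e-nontrivial : ∀ {c} → c ≢ 0# → ∃ λ y → e (c * y) ≡ ℤ.- 1ℤ
  e-nontrivial {c} h with Tr-nontrivial
  ... | t , p = inv c * t , trans (cong e (*-inv-cancelʳ c t h)) (trans (cong sgn p) sgn-1)

  -- Translation by y preserves the sum and negates it.
  ∑-antisymmetric : ∀ {f} y → (∀ x → f (x + y) ≡ ℤ.- f x) → ∑ f ≡ 0ℤ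
  ∑-antisymmetric {f} y h = x≡-x⇒x≡0 (∑ f) (trans (∑-translate y f) (trans (∑-cong h) (∑-neg f)))

  e-shift : ∀ c x y → e (c * y) ≡ ℤ.- 1ℤ → e (c * (x + y)) ≡ ℤ.- e (c * x)
  e-shift c x y p = begin
    e (c * (x + y))          ≡⟨ cong e (distribˡ c x y) ⟩
    e (c * x + c * y)        ≡⟨ e-+ _ _ ⟩
    e (c * x) ⊗ e (c * y)    ≡⟨ cong (e (c * x) ⊗_) p ⟩
    e (c * x) ⊗ ℤ.- 1ℤ       ≡⟨ ℤ-solve 1 (λ x → x ⟨*⟩ (⟨-⟩ ℤ-con 1ℤ) ⟨=⟩ ⟨-⟩ x) refl (e (c * x)) ⟩
    ℤ.- e (c * x)            ∎

  orthogonality : ∀ c → ∑[ x ] e (c * x) ≡ P ⊗ δ c 0#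
  orthogonality c with c ≟ 0#
  ... | yes refl = trans (∑-cong (λ x → trans (cong e (zeroˡ x)) e-0)) (trans ∑-1 (sym (ℤ.*-identityʳ P)))
  ... | no h with e-nontrivial h
  ...   | y , p = trans (∑-antisymmetric y (λ x → e-shift c x y p)) (sym (ℤ.*-zeroʳ P))

  -- The field has degree m + 1 over F_2, so the m-th iterate of Frobenius inverts squaring.
  sqrt : Carrier → Carrier
  sqrt = frob m

  sqrt² : ∀ x → sqrt x * sqrt x ≡ x
  sqrt² x = trans (sym (frob-suc m x)) (fermat x)

  ∑-square : ∀ f → ∑ f ≡ ∑[ x ] f (x * x)
  ∑-square = ∑-bijection (λ x → x * x) sqrt sqrt² (λ x → trans (*-^ x x (2 ℕ.^ m)) (sqrt² x))

  P-nonZero : ℤ.NonZero P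
  P-nonZero = ℕ.m^n≢0 2 (suc m)

  -- The variable of the character sum is squared on purpose: in `e-wp` the term w²z² is then a
  -- square, and under the trace it may be replaced by wz.
  δ-expansion : ∀ x y → P ⊗ δ x y ≡ ∑[ z ] e ((y + x) * (z * z))
  δ-expansion x y = begin
    P ⊗ δ x y                        ≡⟨ cong (P ⊗_) (δ-⇔ (λ p → x≡y⇒x+y≡0 (sym p)) (λ p → sym (x+y≡0⇒x≡y p))) ⟩
    P ⊗ δ (y + x) 0#                 ≡⟨ sym (orthogonality (y + x)) ⟩
    ∑[ z ] e ((y + x) * z)           ≡⟨ ∑-square _ ⟩
    ∑[ z ] e ((y + x) * (z * z))     ∎

  δ-wp : ∀ z → δ (z + z * z) 0# ≡ δ z 0# ⊕ δ z 1#
  δ-wp z with z ≟ 0# | z ≟ 1#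
  ... | yes refl | yes p   = ⊥-elim (1≢0 (sym p))
  ... | yes refl | no _    = δ-≡ (trans (+-identityˡ _) (zeroˡ _))
  ... | no _     | yes refl = δ-≡ (trans (cong (1# +_) (*-identityˡ 1#)) char2)
  ... | no h     | no k    = δ-≢ λ p → go (idempotent⇒Bit (trans (+-comm _ _) p))
    where
    go : ¬ Bit z
    go (inj₁ a) = h a
    go (inj₂ b) = k b

  -- Since e(t²) = e(t), the part quadratic in w becomes linear, with coefficient z + z². The sum
  -- over w can then be evaluated by orthogonality.
  e-wp : ∀ s w z → e (((w * w + w) + s) * (z * z)) ≡ e (s * (z * z)) ⊗ e ((z + z * z) * w)
  e-wp s w z = begin
    e (((w * w + w) + s) * (z * z))
      ≡⟨ cong e (solve 3 (λ s w z → ((w :* w :+ w) :+ s) :* (z :* z) := s :* (z :* z) :+ ((z :* w) :* (z :* w) :+ z :* z :* w)) refl s w z) ⟩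
    e (s * (z * z) + ((z * w) * (z * w) + z * z * w))
      ≡⟨ trans (e-+ _ _) (cong (e (s * (z * z)) ⊗_) (e-+ _ _)) ⟩
    e (s * (z * z)) ⊗ (e ((z * w) * (z * w)) ⊗ e (z * z * w))
      ≡⟨ cong (λ t → e (s * (z * z)) ⊗ (t ⊗ e (z * z * w))) (e-sq (z * w)) ⟩
    e (s * (z * z)) ⊗ (e (z * w) ⊗ e (z * z * w))
      ≡⟨ cong (e (s * (z * z)) ⊗_) (trans (sym (e-+ _ _)) (cong e (sym (distribʳ w z (z * z))))) ⟩
    e (s * (z * z)) ⊗ e ((z + z * z) * w) ∎

  private
    -- Summation over w leaves only the z with z + z² = 0. These are 0 and 1, and they contribute 1
    -- and e(s).
    fibreSum : ∀ s → ∑[ w ] (P ⊗ δ s (w * w + w)) ≡ P ⊗ (1ℤ ⊕ e s)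
    fibreSum s = begin
      ∑[ w ] (P ⊗ δ s (w * w + w))
        ≡⟨ ∑-cong (λ w → δ-expansion s (w * w + w)) ⟩
      ∑[ w ] (∑[ z ] e (((w * w + w) + s) * (z * z)))
        ≡⟨ ∑-cong (λ w → ∑-cong (λ z → e-wp s w z)) ⟩
      ∑[ w ] (∑[ z ] (e (s * (z * z)) ⊗ e ((z + z * z) * w)))
        ≡⟨ ∑-swap _ ⟩
      ∑[ z ] (∑[ w ] (e (s * (z * z)) ⊗ e ((z + z * z) * w)))
        ≡⟨ ∑-cong (λ z → trans (∑-*ˡ (e (s * (z * z))) (λ w → e ((z + z * z) * w)))
                               (cong (e (s * (z * z)) ⊗_) (trans (orthogonality (z + z * z)) (cong (P ⊗_) (δ-wp z))))) ⟩
      ∑[ z ] (e (s * (z * z)) ⊗ (P ⊗ (δ z 0# ⊕ δ z 1#)))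
        ≡⟨ ∑-cong (λ z → ℤ-solve 4 (λ e P a b → e ⟨*⟩ (P ⟨*⟩ (a ⟨+⟩ b)) ⟨=⟩ P ⟨*⟩ (a ⟨*⟩ e ⟨+⟩ b ⟨*⟩ e)) refl (e (s * (z * z))) P (δ z 0#) (δ z 1#)) ⟩
      ∑[ z ] (P ⊗ (δ z 0# ⊗ e (s * (z * z)) ⊕ δ z 1# ⊗ e (s * (z * z))))
        ≡⟨ trans (∑-*ˡ P (λ z → δ z 0# ⊗ e (s * (z * z)) ⊕ δ z 1# ⊗ e (s * (z * z)))) (cong (P ⊗_) (∑-+ (λ z → δ z 0# ⊗ e (s * (z * z))) (λ z → δ z 1# ⊗ e (s * (z * z))))) ⟩
      P ⊗ (∑[ z ] (δ z 0# ⊗ e (s * (z * z))) ⊕ ∑[ z ] (δ z 1# ⊗ e (s * (z * z))))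
        ≡⟨ cong (P ⊗_) (cong₂ _⊕_ (∑-δ 0# (λ z → e (s * (z * z)))) (∑-δ 1# (λ z → e (s * (z * z))))) ⟩
      P ⊗ (e (s * (0# * 0#)) ⊕ e (s * (1# * 1#)))
        ≡⟨ cong (P ⊗_) (cong₂ _⊕_ (trans (cong e (solve 1 (λ s → s :* (con false :* con false) := con false) refl s)) e-0)
                                  (cong e (solve 1 (λ s → s :* (con true :* con true) := s) refl s))) ⟩
      P ⊗ (1ℤ ⊕ e s) ∎

  -- The equation w² + w = s has 1 + e(s) solutions; expand δ by orthogonality.
  ∑-wp : ∀ (g : Carrier → ℤ) → ∑[ w ] g (w * w + w) ≡ ∑[ s ] ((1ℤ ⊕ e s) ⊗ g s)
  ∑-wp g = ℤ.*-cancelˡ-≡ P _ _ {{P-nonZero}} (begin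
    P ⊗ ∑[ w ] g (w * w + w)
      ≡⟨ cong (P ⊗_) (∑-cong (λ w → sym (∑-δ (w * w + w) g))) ⟩
    P ⊗ ∑[ w ] (∑[ s ] (δ s (w * w + w) ⊗ g s))
      ≡⟨ cong (P ⊗_) (∑-swap _) ⟩
    P ⊗ ∑[ s ] (∑[ w ] (δ s (w * w + w) ⊗ g s))
      ≡⟨ sym (∑-*ˡ P (λ s → ∑[ w ] (δ s (w * w + w) ⊗ g s))) ⟩
    ∑[ s ] (P ⊗ ∑[ w ] (δ s (w * w + w) ⊗ g s))
      ≡⟨ ∑-cong (λ s → inner s) ⟩
    ∑[ s ] (P ⊗ ((1ℤ ⊕ e s) ⊗ g s))
      ≡⟨ ∑-*ˡ P (λ s → (1ℤ ⊕ e s) ⊗ g s) ⟩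
    P ⊗ ∑[ s ] ((1ℤ ⊕ e s) ⊗ g s) ∎)
    where
    inner : ∀ s → P ⊗ ∑[ w ] (δ s (w * w + w) ⊗ g s) ≡ P ⊗ ((1ℤ ⊕ e s) ⊗ g s)
    inner s = begin
      P ⊗ ∑[ w ] (δ s (w * w + w) ⊗ g s)     ≡⟨ cong (P ⊗_) (∑-*ʳ (λ w → δ s (w * w + w)) (g s)) ⟩
      P ⊗ (∑[ w ] δ s (w * w + w) ⊗ g s)     ≡⟨ sym (ℤ.*-assoc P _ (g s)) ⟩
      P ⊗ ∑[ w ] δ s (w * w + w) ⊗ g s       ≡⟨ cong (_⊗ g s) (trans (sym (∑-*ˡ P (λ w → δ s (w * w + w)))) (fibreSum s)) ⟩
      P ⊗ (1ℤ ⊕ e s) ⊗ g s                   ≡⟨ ℤ.*-assoc P _ (g s) ⟩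
      P ⊗ ((1ℤ ⊕ e s) ⊗ g s)                 ∎

-- Conjugation, the subfield F_q and its characters.

module QuadraticExtension (k : ℕ) (F : GF2^ (2 ℕ.* suc k)) where
  n : ℕ
  n = suc k

  open Setting n F
  open FieldTheory F
  open Solver₂ using (solve; _:+_; _:*_; _:=_; con)
  open Sums F
  open Traces F
  open Characters F

  conj-+ : ∀ x y → conj (x + y) ≡ conj x + conj y
  conj-+ = frob-+ n

  conj-* : ∀ x y → conj (x * y) ≡ conj x * conj y
  conj-* x y = *-^ x y q

  conj-0 : conj 0# ≡ 0#
  conj-0 = frob-zero n

  conj-1 : conj 1# ≡ 1#
  conj-1 = 1^ q

  conj-conj : ∀ x → conj (conj x) ≡ x
  conj-conj x = begin
    frob n (frob n x)        ≡⟨ sym (frob-∘ n n x) ⟩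
    frob (n ℕ.+ n) x         ≡⟨ cong (λ i → frob (n ℕ.+ i) x) (sym (ℕ.+-identityʳ n)) ⟩
    frob (2 ℕ.* n) x         ≡⟨ fermat x ⟩
    x                        ∎

  conj-≢0 : ∀ {x} → x ≢ 0# → conj x ≢ 0#
  conj-≢0 {x} h p = h (trans (sym (conj-conj x)) (trans (cong conj p) conj-0))

  conj-inv : ∀ x → conj (inv x) ≡ inv (conj x)
  conj-inv x with x ≟ 0#
  ... | yes refl = trans (cong conj inv-0) (trans conj-0 (sym (trans (cong inv conj-0) inv-0)))
  ... | no h = sym (inv-unique (trans (sym (conj-* x (inv x))) (trans (cong conj (inv-r x h)) conj-1)))

  InFq-0 : InFq 0#
  InFq-0 = conj-0

  InFq-1 : InFq 1#
  InFq-1 = conj-1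

  InFq-+ : ∀ {x y} → InFq x → InFq y → InFq (x + y)
  InFq-+ p r = trans (conj-+ _ _) (cong₂ _+_ p r)

  InFq-* : ∀ {x y} → InFq x → InFq y → InFq (x * y)
  InFq-* p r = trans (conj-* _ _) (cong₂ _*_ p r)

  InFq-inv : ∀ {x} → InFq x → InFq (inv x)
  InFq-inv p = trans (conj-inv _) (cong inv p)

  InFq-norm : ∀ x → InFq (x * conj x)
  InFq-norm x = trans (conj-* _ _) (trans (cong (conj x *_) (conj-conj x)) (*-comm _ _))

  τ : Carrier → Carrier
  τ x = x + conj x

  τ-InFq : ∀ x → InFq (τ x)
  τ-InFq x = trans (conj-+ _ _) (trans (cong (conj x +_) (conj-conj x)) (+-comm _ _))

  τ-+ : ∀ x y → τ (x + y) ≡ τ x + τ y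
  τ-+ x y = trans (cong ((x + y) +_) (conj-+ x y))
    (solve 4 (λ a b c d → (a :+ b) :+ (c :+ d) := (a :+ c) :+ (b :+ d)) refl x y (conj x) (conj y))

  τ-* : ∀ {v} x → InFq v → τ (v * x) ≡ v * τ x
  τ-* {v} x p = trans (cong (v * x +_) (trans (conj-* v x) (cong (_* conj x) p))) (sym (distribˡ v x (conj x)))

  τ≡0⇒InFq : ∀ {x} → τ x ≡ 0# → InFq x
  τ≡0⇒InFq p = sym (x+y≡0⇒x≡y p)

  InFq⇒τ≡0 : ∀ {x} → InFq x → τ x ≡ 0#
  InFq⇒τ≡0 p = x≡y⇒x+y≡0 (sym p)

  Trn-Bit : ∀ {x} → InFq x → Bit (Trn x)
  Trn-Bit = T-Bit n

  eₙ : Carrier → ℤ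
  eₙ x = sgn (Trn x)

  eₙ-+ : ∀ {x y} → InFq x → InFq y → eₙ (x + y) ≡ eₙ x ⊗ eₙ y
  eₙ-+ {x} {y} p r = trans (cong sgn (T-+ n x y)) (sgn-+ (Trn-Bit p) (Trn-Bit r))

  eₙ-sq : ∀ {x} → InFq x → eₙ (x * x) ≡ eₙ x
  eₙ-sq {x} p = cong sgn (trans (T-sq n x) (Bit-idem (Trn-Bit p)))

  Tr2n-τ : ∀ x → Tr2n x ≡ Trn (τ x)
  Tr2n-τ x = begin
    T (n ℕ.+ (n ℕ.+ 0)) x      ≡⟨ cong (λ i → T (n ℕ.+ i) x) (ℕ.+-identityʳ n) ⟩
    T (n ℕ.+ n) x              ≡⟨ T-split n n x ⟩
    T n (conj x) + T n x       ≡⟨ +-comm _ _ ⟩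
    T n x + T n (conj x)       ≡⟨ sym (T-+ n x (conj x)) ⟩
    T n (τ x)                  ∎

  Tr2n-Fq : ∀ {x} → InFq x → Tr2n x ≡ 0#
  Tr2n-Fq {x} p = trans (Tr2n-τ x) (trans (cong Trn (InFq⇒τ≡0 p)) (T-0 n))

  e-τ : ∀ x → e x ≡ eₙ (τ x)
  e-τ x = cong sgn (Tr2n-τ x)

  e-Fq : ∀ {x} → InFq x → e x ≡ 1ℤ
  e-Fq p = trans (cong sgn (Tr2n-Fq p)) sgn-0

  e-conj : ∀ x → e (conj x) ≡ e x
  e-conj = e-frob n

  ι : Carrier → ℤ
  ι x = δ (conj x) x

  ι-InFq : ∀ {x} → InFq x → ι x ≡ 1ℤ
  ι-InFq = δ-≡

  ι-∉Fq : ∀ {x} → ¬ InFq x → ι x ≡ 0ℤ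
  ι-∉Fq = δ-≢

  -- The order of F_q. That it equals 2^n is never needed, only its square and Q ≠ 1.
  Q : ℤ
  Q = ∑ ι

  -- F_q is its own annihilator under the trace form: the trace of an element of F_q vanishes in
  -- characteristic 2. If c ∉ F_q then τ(c) ≠ 0, and some translation by an element τ(x) of F_q
  -- reverses the sign of e(cy).
  Fq-orthogonality : ∀ c → ∑[ y ] (ι y ⊗ e (c * y)) ≡ Q ⊗ ι c
  Fq-orthogonality c with conj c ≟ c
  ... | yes p = begin
    ∑[ y ] (ι y ⊗ e (c * y))   ≡⟨ ∑-cong (λ y → δ-cong (λ r → e-Fq (InFq-* p r))) ⟩
    ∑[ y ] (ι y ⊗ 1ℤ)          ≡⟨ ∑-*ʳ ι 1ℤ ⟩
    Q ⊗ 1ℤ                     ∎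
  ... | no h with e-nontrivial (λ p → h (τ≡0⇒InFq {c} p))
  ...   | x , p = trans (∑-antisymmetric (τ x) anti) (sym (ℤ.*-zeroʳ Q))
    where
    -- `e` is invariant under conjugation, so `τ` can be moved from x to c.
    e-cτx : e (c * τ x) ≡ ℤ.- 1ℤ
    e-cτx = begin
      e (c * (x + conj x))                   ≡⟨ cong e (distribˡ c x (conj x)) ⟩
      e (c * x + c * conj x)                 ≡⟨ e-+ _ _ ⟩
      e (c * x) ⊗ e (c * conj x)             ≡⟨ cong (e (c * x) ⊗_) (sym (e-conj _)) ⟩
      e (c * x) ⊗ e (conj (c * conj x))      ≡⟨ cong (λ z → e (c * x) ⊗ e z) (trans (conj-* c (conj x)) (cong (conj c *_) (conj-conj x))) ⟩
      e (c * x) ⊗ e (conj c * x)             ≡⟨ sym (e-+ _ _) ⟩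
      e (c * x + conj c * x)                 ≡⟨ cong e (sym (distribʳ x c (conj c))) ⟩
      e (τ c * x)                            ≡⟨ p ⟩
      ℤ.- 1ℤ                                 ∎
    ι-shift : ∀ y → ι (y + τ x) ≡ ι y
    ι-shift y = δ-⇔
      (λ r → subst InFq (+-involutive y (τ x)) (InFq-+ r (τ-InFq x)))
      (λ r → InFq-+ r (τ-InFq x))
    anti : ∀ y → ι (y + τ x) ⊗ e (c * (y + τ x)) ≡ ℤ.- (ι y ⊗ e (c * y))
    anti y = trans (cong₂ _⊗_ (ι-shift y) (e-shift c y (τ x) e-cτx)) (sym (ℤ.neg-distribʳ-* (ι y) (e (c * y))))

  -- Double counting of Σ_{c ∈ F} Σ_{y ∈ F_q} e(cy).
  Q*Q≡P : Q ⊗ Q ≡ P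
  Q*Q≡P = begin
    Q ⊗ Q                                       ≡⟨ sym (∑-*ˡ Q ι) ⟩
    ∑[ c ] (Q ⊗ ι c)                            ≡⟨ ∑-cong (λ c → sym (Fq-orthogonality c)) ⟩
    ∑[ c ] (∑[ y ] (ι y ⊗ e (c * y)))           ≡⟨ ∑-swap (λ c y → ι y ⊗ e (c * y)) ⟩
    ∑[ y ] (∑[ c ] (ι y ⊗ e (c * y)))           ≡⟨ ∑-cong inner ⟩
    ∑[ y ] (P ⊗ (δ y 0# ⊗ ι y))                 ≡⟨ ∑-*ˡ P (λ y → δ y 0# ⊗ ι y) ⟩
    P ⊗ ∑[ y ] (δ y 0# ⊗ ι y)                   ≡⟨ cong (P ⊗_) (trans (∑-δ 0# ι) (ι-InFq InFq-0)) ⟩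
    P ⊗ 1ℤ                                      ≡⟨ ℤ.*-identityʳ P ⟩
    P                                           ∎
    where
    inner : ∀ y → ∑[ c ] (ι y ⊗ e (c * y)) ≡ P ⊗ (δ y 0# ⊗ ι y)
    inner y = begin
      ∑[ c ] (ι y ⊗ e (c * y))     ≡⟨ ∑-*ˡ (ι y) (λ c → e (c * y)) ⟩
      ι y ⊗ ∑[ c ] e (c * y)       ≡⟨ cong (ι y ⊗_) (trans (∑-cong (λ c → cong e (*-comm c y))) (orthogonality y)) ⟩
      ι y ⊗ (P ⊗ δ y 0#)           ≡⟨ ℤ-solve 3 (λ i P d → i ⟨*⟩ (P ⟨*⟩ d) ⟨=⟩ P ⟨*⟩ (d ⟨*⟩ i)) refl (ι y) P (δ y 0#) ⟩
      P ⊗ (δ y 0# ⊗ ι y)           ∎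

  -- Allows cancelling the size of a punctured line. Q = 1 would force the field order 2^(2n) to be
  -- 1.
  Q-1-nonZero : ℤ.NonZero (Q ⊖ 1ℤ)
  Q-1-nonZero = ℤ.≢-nonZero λ p → absurd (ℤ.i-j≡0⇒i≡j Q 1ℤ p)
    where
    absurd : Q ≢ 1ℤ
    absurd p = ℕ.<⇒≢ (ℕ.^-monoʳ-< 2 (ℕ.s≤s (ℕ.s≤s ℕ.z≤n)) {0} {2 ℕ.* n} (ℕ.s≤s ℕ.z≤n))
      (ℤ.+-injective (trans (sym (cong₂ _⊗_ p p)) Q*Q≡P))

  private
    -- The absolute trace factors through `τ`, so an element t of trace 1 has τ(t) ≠ 0. Dividing t
    -- by τ(t) normalises it, because `τ` is F_q-linear.
    w₀-spec : ∃ λ w → τ w ≡ 1#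
    w₀-spec with Tr-nontrivial
    ... | t , p = inv s * t , trans (τ-* t (InFq-inv (τ-InFq t))) (inv-l s s≢0)
      where
      s = τ t
      s≢0 : s ≢ 0#
      s≢0 z = 1≢0 (trans (sym p) (trans (Tr2n-τ t) (trans (cong Trn z) (T-0 n))))

  w₀ : Carrier
  w₀ = proj₁ w₀-spec

  τ-w₀ : τ w₀ ≡ 1#
  τ-w₀ = proj₂ w₀-spec

  w₀∉Fq : ¬ InFq w₀
  w₀∉Fq p = 1≢0 (trans (sym τ-w₀) (InFq⇒τ≡0 p))

  -- Expresses the character of F_q given by Tr_n as the restriction of a character of the large
  -- field, so that sums over F_q fall under `Fq-orthogonality`.
  e-w₀ : ∀ {s} → InFq s → e (w₀ * s) ≡ eₙ s
  e-w₀ {s} p = trans (e-τ _) (cong eₙ (begin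
    τ (w₀ * s)   ≡⟨ cong τ (*-comm w₀ s) ⟩
    τ (s * w₀)   ≡⟨ τ-* w₀ p ⟩
    s * τ w₀     ≡⟨ cong (s *_) τ-w₀ ⟩
    s * 1#       ≡⟨ *-identityʳ s ⟩
    s            ∎))

  κ : Carrier → ℤ
  κ v = ι v ⊗ ν v

  κ-cong : ∀ {v x y} → (InFq v → v ≢ 0# → x ≡ y) → κ v ⊗ x ≡ κ v ⊗ y
  κ-cong {v} {x} {y} h = trans (ℤ.*-assoc (ι v) (ν v) x)
    (trans (δ-cong {conj v} {v} (λ p → ν-cong {v} (λ r → h p r))) (sym (ℤ.*-assoc (ι v) (ν v) y)))

  ∑-κ : ∑ κ ≡ Q ⊖ 1ℤ
  ∑-κ = begin
    ∑[ v ] (ι v ⊗ (1ℤ ⊖ δ v 0#))         ≡⟨ ∑-cong (λ v → ℤ-solve 2 (λ i d → i ⟨*⟩ (ℤ-con 1ℤ ⟨-⟩ d) ⟨=⟩ i ⟨-⟩ d ⟨*⟩ i) refl (ι v) (δ v 0#)) ⟩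
    ∑[ v ] (ι v ⊖ δ v 0# ⊗ ι v)          ≡⟨ ∑-- ι (λ v → δ v 0# ⊗ ι v) ⟩
    Q ⊖ ∑[ v ] (δ v 0# ⊗ ι v)            ≡⟨ cong (Q ⊖_) (trans (∑-δ 0# ι) (ι-InFq InFq-0)) ⟩
    Q ⊖ 1ℤ                               ∎

  -- Functions constant on punctured lines and their Walsh transform.

  Homogeneous : (Carrier → ℤ) → Set
  Homogeneous f = ∀ v x → InFq v → v ≢ 0# → f (v * x) ≡ f x

  ∑-κ-homogeneous : ∀ f → Homogeneous f → ∀ c → ∑[ v ] (κ v ⊗ f (v * c)) ≡ (Q ⊖ 1ℤ) ⊗ f c
  ∑-κ-homogeneous f hom c = begin
    ∑[ v ] (κ v ⊗ f (v * c))     ≡⟨ ∑-cong (λ v → κ-cong {v} (hom v c)) ⟩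
    ∑[ v ] (κ v ⊗ f c)           ≡⟨ ∑-*ʳ κ (f c) ⟩
    ∑ κ ⊗ f c                    ≡⟨ cong (_⊗ f c) ∑-κ ⟩
    (Q ⊖ 1ℤ) ⊗ f c               ∎

  ∑₁ : (Carrier → ℤ) → ℤ
  ∑₁ f = ∑[ w ] (δ (τ w) 1# ⊗ f w)

  ∑₁-cong : ∀ {f g} → (∀ w → τ w ≡ 1# → f w ≡ g w) → ∑₁ f ≡ ∑₁ g
  ∑₁-cong h = ∑-cong (λ w → δ-cong (h w))

  private
    -- A nonzero x either lies in F_q or has τ(x) ≠ 0, never both.
    split : ∀ (f : Carrier → ℤ) x → ν x ⊗ f x ≡ κ x ⊗ f x ⊕ ν (τ x) ⊗ f x
    split f x with x ≟ 0#
    ... | yes refl = sym (cong₂ _⊕_ (cong (_⊗ f 0#) (ℤ.*-zeroʳ (ι 0#)))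
                                    (cong (_⊗ f 0#) (ν-0 (InFq⇒τ≡0 InFq-0))))
    ... | no h = begin
      (1ℤ ⊖ 0ℤ) ⊗ f x
        ≡⟨ ℤ-solve 2 (λ i y → (ℤ-con 1ℤ ⟨-⟩ ℤ-con 0ℤ) ⟨*⟩ y ⟨=⟩ i ⟨*⟩ (ℤ-con 1ℤ ⟨-⟩ ℤ-con 0ℤ) ⟨*⟩ y ⟨+⟩ (ℤ-con 1ℤ ⟨-⟩ i) ⟨*⟩ y) refl (ι x) (f x) ⟩
      ι x ⊗ (1ℤ ⊖ 0ℤ) ⊗ f x ⊕ (1ℤ ⊖ ι x) ⊗ f x
        ≡⟨ cong (λ i → ι x ⊗ (1ℤ ⊖ 0ℤ) ⊗ f x ⊕ (1ℤ ⊖ i) ⊗ f x) (δ-⇔ InFq⇒τ≡0 τ≡0⇒InFq) ⟩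
      ι x ⊗ (1ℤ ⊖ 0ℤ) ⊗ f x ⊕ (1ℤ ⊖ δ (τ x) 0#) ⊗ f x ∎

    κ-τ : ∀ x → κ (τ x) ≡ ν (τ x)
    κ-τ x = trans (cong (_⊗ ν (τ x)) (ι-InFq (τ-InFq x))) (ℤ.*-identityˡ _)

    -- Multiplication by v in F_q^* carries the fibre τ = 1 onto the fibre τ = v and does not change
    -- `f`.
    line : ∀ f → Homogeneous f → ∀ v → InFq v → v ≢ 0# → ∑[ x ] (δ v (τ x) ⊗ f x) ≡ ∑₁ f
    line f hom v p h = begin
      ∑[ x ] (δ v (τ x) ⊗ f x)                 ≡⟨ ∑-scale v h _ ⟩
      ∑[ w ] (δ v (τ (v * w)) ⊗ f (v * w))     ≡⟨ ∑-cong (λ w → cong₂ _⊗_ (δ-⇔ (to w) (from w)) (hom v w p h)) ⟩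
      ∑[ w ] (δ (τ w) 1# ⊗ f w)                ∎
      where
      to : ∀ w → v ≡ τ (v * w) → τ w ≡ 1#
      to w r = sym (*-cancel v h (trans (*-identityʳ v) (trans r (τ-* w p))))
      from : ∀ w → τ w ≡ 1# → v ≡ τ (v * w)
      from w r = sym (trans (τ-* w p) (trans (cong (v *_) r) (*-identityʳ v)))

  -- The points of the projective line over F_q are represented by 1 and by the w with w + conj w = 1.
  ∑-projective : ∀ f → Homogeneous f → ∑[ x ] (ν x ⊗ f x) ≡ (Q ⊖ 1ℤ) ⊗ (f 1# ⊕ ∑₁ f)
  ∑-projective f hom = begin
    ∑[ x ] (ν x ⊗ f x)                                  ≡⟨ ∑-cong (split f) ⟩
    ∑[ x ] (κ x ⊗ f x ⊕ ν (τ x) ⊗ f x)                  ≡⟨ ∑-+ (λ x → κ x ⊗ f x) (λ x → ν (τ x) ⊗ f x) ⟩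
    ∑[ x ] (κ x ⊗ f x) ⊕ ∑[ x ] (ν (τ x) ⊗ f x)         ≡⟨ cong₂ _⊕_ onFq offFq ⟩
    (Q ⊖ 1ℤ) ⊗ f 1# ⊕ (Q ⊖ 1ℤ) ⊗ ∑₁ f                   ≡⟨ sym (ℤ.*-distribˡ-+ (Q ⊖ 1ℤ) (f 1#) (∑₁ f)) ⟩
    (Q ⊖ 1ℤ) ⊗ (f 1# ⊕ ∑₁ f)                            ∎
    where
    onFq : ∑[ x ] (κ x ⊗ f x) ≡ (Q ⊖ 1ℤ) ⊗ f 1#
    onFq = trans (∑-cong (λ x → cong (λ z → κ x ⊗ f z) (sym (*-identityʳ x)))) (∑-κ-homogeneous f hom 1#)
    offFq : ∑[ x ] (ν (τ x) ⊗ f x) ≡ (Q ⊖ 1ℤ) ⊗ ∑₁ f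
    offFq = begin
      ∑[ x ] (ν (τ x) ⊗ f x)                            ≡⟨ ∑-cong (λ x → cong (_⊗ f x) (sym (κ-τ x))) ⟩
      ∑[ x ] (κ (τ x) ⊗ f x)                            ≡⟨ ∑-cong (λ x → sym (∑-δ (τ x) (λ v → κ v ⊗ f x))) ⟩
      ∑[ x ] (∑[ v ] (δ v (τ x) ⊗ (κ v ⊗ f x)))         ≡⟨ ∑-swap (λ x v → δ v (τ x) ⊗ (κ v ⊗ f x)) ⟩
      ∑[ v ] (∑[ x ] (δ v (τ x) ⊗ (κ v ⊗ f x)))         ≡⟨ ∑-cong (λ v → ∑-cong (λ x →
                                                             ℤ-solve 3 (λ d k y → d ⟨*⟩ (k ⟨*⟩ y) ⟨=⟩ k ⟨*⟩ (d ⟨*⟩ y)) refl (δ v (τ x)) (κ v) (f x))) ⟩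
      ∑[ v ] (∑[ x ] (κ v ⊗ (δ v (τ x) ⊗ f x)))         ≡⟨ ∑-cong (λ v → ∑-*ˡ (κ v) (λ x → δ v (τ x) ⊗ f x)) ⟩
      ∑[ v ] (κ v ⊗ ∑[ x ] (δ v (τ x) ⊗ f x))           ≡⟨ ∑-cong (λ v → κ-cong {v} (line f hom v)) ⟩
      ∑[ v ] (κ v ⊗ ∑₁ f)                               ≡⟨ ∑-*ʳ κ (∑₁ f) ⟩
      ∑ κ ⊗ ∑₁ f                                        ≡⟨ cong (_⊗ ∑₁ f) ∑-κ ⟩
      (Q ⊖ 1ℤ) ⊗ ∑₁ f                                   ∎

  ∑-ι-homogeneous : ∀ f → Homogeneous f → ∀ c → ∑[ y ] (ι y ⊗ f (y * c)) ≡ f 0# ⊕ (Q ⊖ 1ℤ) ⊗ f c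
  ∑-ι-homogeneous f hom c = begin
    ∑[ y ] (ι y ⊗ f (y * c))                                  ≡⟨ ∑-ν _ ⟩
    ι 0# ⊗ f (0# * c) ⊕ ∑[ y ] (ν y ⊗ (ι y ⊗ f (y * c)))      ≡⟨ cong₂ _⊕_ at0 rest ⟩
    f 0# ⊕ (Q ⊖ 1ℤ) ⊗ f c                                     ∎
    where
    at0 : ι 0# ⊗ f (0# * c) ≡ f 0#
    at0 = trans (cong₂ _⊗_ (ι-InFq InFq-0) (cong f (zeroˡ c))) (ℤ.*-identityˡ _)
    rest : ∑[ y ] (ν y ⊗ (ι y ⊗ f (y * c))) ≡ (Q ⊖ 1ℤ) ⊗ f c
    rest = trans (∑-cong (λ y → ℤ-solve 3 (λ a b z → a ⟨*⟩ (b ⟨*⟩ z) ⟨=⟩ b ⟨*⟩ a ⟨*⟩ z) refl (ν y) (ι y) (f (y * c))))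
                 (∑-κ-homogeneous f hom c)

  -- Equivalently, the sum over the whole field is Q·f(0), which is exactly what the formula for the
  -- Walsh coefficient requires at ω = 0.
  Balanced : (Carrier → ℤ) → Set
  Balanced f = ∑[ x ] (ν x ⊗ f x) ≡ (Q ⊖ 1ℤ) ⊗ f 0#

  -- Let W be the sum on the left. For ω ≠ 0, summing its scaled forms over v ∈ F_q^* turns the
  -- character into Q·[ωx ∈ F_q] - 1. The first part sees only the line through 1/ω and gives Q(g(0)
  -- + (Q - 1) g(1/ω)). The second gives the total sum Q·g(0), so that (Q - 1)W = (Q - 1) Q g(1/ω).
  transform-Balanced : ∀ g → Homogeneous g → Balanced g → ∀ ω → ∑[ x ] (g x ⊗ e (ω * x)) ≡ Q ⊗ g (inv ω)
  transform-Balanced g hom bal ω with ω ≟ 0#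
  ... | yes refl = begin
    ∑[ x ] (g x ⊗ e (0# * x))      ≡⟨ ∑-cong (λ x → trans (cong (g x ⊗_) (trans (cong e (zeroˡ x)) e-0)) (ℤ.*-identityʳ (g x))) ⟩
    ∑ g                            ≡⟨ ∑-ν g ⟩
    g 0# ⊕ ∑[ x ] (ν x ⊗ g x)      ≡⟨ cong (g 0# ⊕_) bal ⟩
    g 0# ⊕ (Q ⊖ 1ℤ) ⊗ g 0#         ≡⟨ ℤ-solve 2 (λ g q → g ⟨+⟩ (q ⟨-⟩ ℤ-con 1ℤ) ⟨*⟩ g ⟨=⟩ q ⟨*⟩ g) refl (g 0#) Q ⟩
    -- The convention 1/0 = 0 makes the formula uniform in ω.
    Q ⊗ g 0#                       ≡⟨ cong (λ z → Q ⊗ g z) (sym inv-0) ⟩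
    Q ⊗ g (inv 0#)                 ∎
  ... | no h = ℤ.*-cancelˡ-≡ (Q ⊖ 1ℤ) _ _ {{Q-1-nonZero}} (begin
    (Q ⊖ 1ℤ) ⊗ W                                             ≡⟨ cong (_⊗ W) (sym ∑-κ) ⟩
    ∑ κ ⊗ W                                                  ≡⟨ sym (∑-*ʳ κ W) ⟩
    ∑[ v ] (κ v ⊗ W)                                         ≡⟨ ∑-cong (λ v → κ-cong {v} (W-scaled v)) ⟩
    ∑[ v ] (κ v ⊗ ∑[ x ] (g x ⊗ e ((ω * x) * v)))            ≡⟨ ∑-cong (λ v → sym (∑-*ˡ (κ v) (λ x → g x ⊗ e ((ω * x) * v)))) ⟩
    ∑[ v ] (∑[ x ] (κ v ⊗ (g x ⊗ e ((ω * x) * v))))          ≡⟨ ∑-swap (λ v x → κ v ⊗ (g x ⊗ e ((ω * x) * v))) ⟩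
    ∑[ x ] (∑[ v ] (κ v ⊗ (g x ⊗ e ((ω * x) * v))))          ≡⟨ ∑-cong inner ⟩
    ∑[ x ] (Q ⊗ (ι (ω * x) ⊗ g x) ⊖ g x)                     ≡⟨ ∑-- (λ x → Q ⊗ (ι (ω * x) ⊗ g x)) g ⟩
    ∑[ x ] (Q ⊗ (ι (ω * x) ⊗ g x)) ⊖ ∑ g                     ≡⟨ cong₂ _⊖_ (trans (∑-*ˡ Q (λ x → ι (ω * x) ⊗ g x)) (cong (Q ⊗_) onLine)) (trans (∑-ν g) (cong (g 0# ⊕_) bal)) ⟩
    Q ⊗ (g 0# ⊕ (Q ⊖ 1ℤ) ⊗ g (inv ω)) ⊖ (g 0# ⊕ (Q ⊖ 1ℤ) ⊗ g 0#)
                                                             ≡⟨ ℤ-solve 3 (λ q a b → q ⟨*⟩ (a ⟨+⟩ (q ⟨-⟩ ℤ-con 1ℤ) ⟨*⟩ b) ⟨-⟩ (a ⟨+⟩ (q ⟨-⟩ ℤ-con 1ℤ) ⟨*⟩ a)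
                                                                                    ⟨=⟩ (q ⟨-⟩ ℤ-con 1ℤ) ⟨*⟩ (q ⟨*⟩ b)) refl Q (g 0#) (g (inv ω)) ⟩
    (Q ⊖ 1ℤ) ⊗ (Q ⊗ g (inv ω))                               ∎)
    where
    W : ℤ
    W = ∑[ x ] (g x ⊗ e (ω * x))
    W-scaled : ∀ v → InFq v → v ≢ 0# → W ≡ ∑[ x ] (g x ⊗ e ((ω * x) * v))
    W-scaled v p r = trans (∑-scale v r (λ x → g x ⊗ e (ω * x)))
      (∑-cong (λ x → cong₂ _⊗_ (hom v x p r) (cong e (solve 3 (λ w v x → w :* (v :* x) := (w :* x) :* v) refl ω v x))))
    κ-sum : ∀ c → ∑[ v ] (κ v ⊗ e (c * v)) ≡ Q ⊗ ι c ⊖ 1ℤ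
    κ-sum c = begin
      ∑[ v ] (κ v ⊗ e (c * v))
        ≡⟨ ∑-cong (λ v → ℤ-solve 3 (λ i d z → i ⟨*⟩ (ℤ-con 1ℤ ⟨-⟩ d) ⟨*⟩ z ⟨=⟩ i ⟨*⟩ z ⟨-⟩ d ⟨*⟩ (i ⟨*⟩ z)) refl (ι v) (δ v 0#) (e (c * v))) ⟩
      ∑[ v ] (ι v ⊗ e (c * v) ⊖ δ v 0# ⊗ (ι v ⊗ e (c * v)))
        ≡⟨ ∑-- (λ v → ι v ⊗ e (c * v)) (λ v → δ v 0# ⊗ (ι v ⊗ e (c * v))) ⟩
      ∑[ v ] (ι v ⊗ e (c * v)) ⊖ ∑[ v ] (δ v 0# ⊗ (ι v ⊗ e (c * v)))
        ≡⟨ cong₂ _⊖_ (Fq-orthogonality c) (trans (∑-δ 0# (λ v → ι v ⊗ e (c * v)))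
             (cong₂ _⊗_ (ι-InFq InFq-0) (trans (cong e (zeroʳ c)) e-0))) ⟩
      Q ⊗ ι c ⊖ 1ℤ ∎
    inner : ∀ x → ∑[ v ] (κ v ⊗ (g x ⊗ e ((ω * x) * v))) ≡ Q ⊗ (ι (ω * x) ⊗ g x) ⊖ g x
    inner x = begin
      ∑[ v ] (κ v ⊗ (g x ⊗ e ((ω * x) * v)))
        ≡⟨ ∑-cong (λ v → ℤ-solve 3 (λ a b c → a ⟨*⟩ (b ⟨*⟩ c) ⟨=⟩ b ⟨*⟩ (a ⟨*⟩ c)) refl (κ v) (g x) (e ((ω * x) * v))) ⟩
      ∑[ v ] (g x ⊗ (κ v ⊗ e ((ω * x) * v)))
        ≡⟨ ∑-*ˡ (g x) (λ v → κ v ⊗ e ((ω * x) * v)) ⟩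
      g x ⊗ ∑[ v ] (κ v ⊗ e ((ω * x) * v))
        ≡⟨ cong (g x ⊗_) (κ-sum (ω * x)) ⟩
      g x ⊗ (Q ⊗ ι (ω * x) ⊖ 1ℤ)
        ≡⟨ ℤ-solve 3 (λ g q i → g ⟨*⟩ (q ⟨*⟩ i ⟨-⟩ ℤ-con 1ℤ) ⟨=⟩ q ⟨*⟩ (i ⟨*⟩ g) ⟨-⟩ g) refl (g x) Q (ι (ω * x)) ⟩
      Q ⊗ (ι (ω * x) ⊗ g x) ⊖ g x ∎
    onLine : ∑[ x ] (ι (ω * x) ⊗ g x) ≡ g 0# ⊕ (Q ⊖ 1ℤ) ⊗ g (inv ω)
    onLine = begin
      ∑[ x ] (ι (ω * x) ⊗ g x)                            ≡⟨ ∑-scale (inv ω) (inv-≢0 h) (λ x → ι (ω * x) ⊗ g x) ⟩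
      ∑[ y ] (ι (ω * (inv ω * y)) ⊗ g (inv ω * y))        ≡⟨ ∑-cong (λ y → cong₂ (λ a b → ι a ⊗ g b) (*-inv-cancelʳ ω y h) (*-comm _ _)) ⟩
      ∑[ y ] (ι y ⊗ g (y * inv ω))                        ≡⟨ ∑-ι-homogeneous g hom (inv ω) ⟩
      g 0# ⊕ (Q ⊖ 1ℤ) ⊗ g (inv ω)                         ∎

  -- The dual of such a function f is ω ↦ f(1/ω).
  Balanced⇒Bent : ∀ f → (∀ x → Bit (f x)) → Homogeneous (sgn ∘ f) → Balanced (sgn ∘ f) → Bent f
  Balanced⇒Bent f bit hom bal ω = begin
    walsh f ω ⊗ walsh f ω                                   ≡⟨ cong (λ z → z ⊗ z) W≡ ⟩
    (Q ⊗ sgn (f (inv ω))) ⊗ (Q ⊗ sgn (f (inv ω)))           ≡⟨ ℤ-solve 2 (λ q s → (q ⟨*⟩ s) ⟨*⟩ (q ⟨*⟩ s) ⟨=⟩ (q ⟨*⟩ q) ⟨*⟩ (s ⟨*⟩ s)) refl Q (sgn (f (inv ω))) ⟩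
    (Q ⊗ Q) ⊗ (sgn (f (inv ω)) ⊗ sgn (f (inv ω)))           ≡⟨ cong₂ _⊗_ Q*Q≡P (sgn-² (f (inv ω))) ⟩
    P ⊗ 1ℤ                                                  ≡⟨ ℤ.*-identityʳ P ⟩
    P                                                       ∎
    where
    W≡ : walsh f ω ≡ Q ⊗ sgn (f (inv ω))
    W≡ = trans (∑-cong (λ x → sgn-+ (bit x) (Tr-Bit (ω * x)))) (transform-Balanced (sgn ∘ f) hom bal ω)

-- Kloosterman sums and the sum of e(c·conj(y)/y).

module ExponentialSums (k : ℕ) (F : GF2^ (2 ℕ.* suc k)) where
  open QuadraticExtension k F
  open Setting n F
  open FieldTheory F
  open Solver₂ using (solve; _:+_; _:*_; _:=_; con)
  open Sums F
  open Traces F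
  open Characters F

  -- The Artin-Schreier map, usually written ℘.
  wp : Carrier → Carrier
  wp w = w * w + w

  τ-wp : ∀ w → τ (wp w) ≡ τ w * τ w + τ w
  τ-wp w = trans (cong (wp w +_) (trans (conj-+ _ _) (cong (_+ conj w) (conj-* w w))))
    (solve 2 (λ w v → (w :* w :+ w) :+ (v :* v :+ v) := (w :+ v) :* (w :+ v) :+ (w :+ v)) refl w (conj w))

  eₙ-wp : ∀ w → eₙ (wp w) ≡ sgn (τ w)
  eₙ-wp w = cong sgn (trans (T-wp n w) (+-comm _ _))

  -- τ(w² + w) = τ(w)² + τ(w) vanishes exactly for τ(w) ∈ {0, 1}, and the sign of Tr_n(w² + w) tells
  -- these two values apart. The indicator of the fibre thus becomes a function of w² + w, as `∑-wp`
  -- demands; the factor 2 avoids a half.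
  δ-τ-wp : ∀ w → ℤ.+ 2 ⊗ δ (τ w) 1# ≡ ι (wp w) ⊗ (1ℤ ⊖ eₙ (wp w))
  δ-τ-wp w with τ w ≟ 1#
  ... | yes p = sym (cong₂ (λ i s → i ⊗ (1ℤ ⊖ s)) (ι-InFq wp∈Fq) (trans (eₙ-wp w) (trans (cong sgn p) sgn-1)))
    where
    wp∈Fq : InFq (wp w)
    wp∈Fq = τ≡0⇒InFq (trans (τ-wp w) (trans (cong (λ z → z * z + z) p) (trans (cong (_+ 1#) (*-identityˡ 1#)) char2)))
  ... | no h with conj (wp w) ≟ wp w
  ...   | no _ = refl
  ...   | yes r with idempotent⇒Bit (trans (sym (τ-wp w)) (InFq⇒τ≡0 r))
  ...     | inj₂ o = ⊥-elim (h o)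
  ...     | inj₁ z = sym (cong (λ s → 1ℤ ⊗ (1ℤ ⊖ s)) (trans (eₙ-wp w) (trans (cong sgn z) sgn-0)))

  ι-sq : ∀ x → ι (x * x) ≡ ι x
  ι-sq x = δ-⇔ to (λ p → InFq-* p p)
    where
    to : InFq (x * x) → InFq x
    to p = τ≡0⇒InFq (x²≡0⇒x≡0 (trans (solve 2 (λ x y → (x :+ y) :* (x :+ y) := x :* x :+ y :* y) refl x (conj x))
                                     (x≡y⇒x+y≡0 (sym (trans (sym (conj-* x x)) p)))))

  ι-inv : ∀ x → ι (inv x) ≡ ι x
  ι-inv x = δ-⇔ (λ p → subst InFq (inv-involutive x) (InFq-inv p)) InFq-inv

  ι-* : ∀ {v} → InFq v → v ≢ 0# → ∀ x → ι (v * x) ≡ ι x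
  ι-* {v} p h x = δ-⇔ (λ r → subst InFq (*-inv-cancelˡ v x h) (InFq-* (InFq-inv p) r)) (InFq-* p)

  -- On F_q the summand is the restriction of e(w₀s), and w₀ lies outside the annihilator F_q.
  ∑-ι-eₙ : ∑[ s ] (ι s ⊗ eₙ s) ≡ 0ℤ
  ∑-ι-eₙ = begin
    ∑[ s ] (ι s ⊗ eₙ s)          ≡⟨ ∑-cong (λ s → δ-cong (λ p → sym (e-w₀ p))) ⟩
    ∑[ s ] (ι s ⊗ e (w₀ * s))    ≡⟨ Fq-orthogonality w₀ ⟩
    Q ⊗ ι w₀                     ≡⟨ cong (Q ⊗_) (ι-∉Fq w₀∉Fq) ⟩
    Q ⊗ 0ℤ                       ≡⟨ ℤ.*-zeroʳ Q ⟩
    0ℤ                           ∎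

  module _ (N : Carrier) (N∈Fq : InFq N) (N≢0 : N ≢ 0#) where

    private
      g : Carrier → ℤ
      g s = eₙ (N * inv s)

    -- With 1/0 = 0 the map s ↦ N/s permutes F_q.
    ∑-ι-eₙ-inv : ∑[ s ] (ι s ⊗ g s) ≡ 0ℤ
    ∑-ι-eₙ-inv = begin
      ∑[ s ] (ι s ⊗ eₙ (N * inv s))               ≡⟨ ∑-cong (λ s → cong (_⊗ eₙ (N * inv s)) (sym (trans (ι-* N∈Fq N≢0 (inv s)) (ι-inv s)))) ⟩
      ∑[ s ] (ι (N * inv s) ⊗ eₙ (N * inv s))     ≡⟨ sym (∑-inv (λ s → ι (N * s) ⊗ eₙ (N * s))) ⟩
      ∑[ s ] (ι (N * s) ⊗ eₙ (N * s))             ≡⟨ sym (∑-scale N N≢0 (λ s → ι s ⊗ eₙ s)) ⟩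
      ∑[ s ] (ι s ⊗ eₙ s)                         ≡⟨ ∑-ι-eₙ ⟩
      0ℤ                                          ∎

    Kloosterman-² : Kloosterman (N * N) ≡ ∑[ s ] (ι s ⊗ (eₙ s ⊗ g s))
    Kloosterman-² = begin
      Kloosterman (N * N)
        ≡⟨ Σℤ-filter conj id (λ x → eₙ (inv x + N * N * x)) ⟩
      ∑[ x ] (ι x ⊗ eₙ (inv x + N * N * x))
        ≡⟨ ∑-square (λ x → ι x ⊗ eₙ (inv x + N * N * x)) ⟩
      ∑[ x ] (ι (x * x) ⊗ eₙ (inv (x * x) + N * N * (x * x)))
        ≡⟨ ∑-cong (λ x → trans (cong (_⊗ eₙ (inv (x * x) + N * N * (x * x))) (ι-sq x)) (δ-cong (unsquare x))) ⟩
      ∑[ x ] (ι x ⊗ eₙ (inv x + N * x))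
        ≡⟨ ∑-inv (λ x → ι x ⊗ eₙ (inv x + N * x)) ⟩
      ∑[ x ] (ι (inv x) ⊗ eₙ (inv (inv x) + N * inv x))
        ≡⟨ ∑-cong (λ x → trans (cong₂ _⊗_ (ι-inv x) (cong (λ z → eₙ (z + N * inv x)) (inv-involutive x)))
                               (δ-cong (λ p → eₙ-+ p (InFq-* N∈Fq (InFq-inv p))))) ⟩
      ∑[ x ] (ι x ⊗ (eₙ x ⊗ g x)) ∎
      where
      unsquare : ∀ x → InFq x → eₙ (inv (x * x) + N * N * (x * x)) ≡ eₙ (inv x + N * x)
      unsquare x p = trans (cong eₙ (trans (cong (_+ N * N * (x * x)) (inv-* x x))
        (solve 3 (λ i N x → i :* i :+ N :* N :* (x :* x) := (i :+ N :* x) :* (i :+ N :* x)) refl (inv x) N x)))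
        (eₙ-sq (InFq-+ (InFq-inv p) (InFq-* N∈Fq p)))

    -- For s ∈ F_q the equation w² + w = s is solvable in F, and w + conj w = Tr_n(s) for each of its two solutions.
    ∑₁-Kloosterman : ∑₁ (λ w → g (wp w)) ≡ ℤ.- Kloosterman (N * N)
    ∑₁-Kloosterman = ℤ.*-cancelˡ-≡ (ℤ.+ 2) _ _ (begin
      ℤ.+ 2 ⊗ ∑[ w ] (δ (τ w) 1# ⊗ g (wp w))
        ≡⟨ sym (∑-*ˡ (ℤ.+ 2) (λ w → δ (τ w) 1# ⊗ g (wp w))) ⟩
      ∑[ w ] (ℤ.+ 2 ⊗ (δ (τ w) 1# ⊗ g (wp w)))
        ≡⟨ ∑-cong (λ w → trans (sym (ℤ.*-assoc (ℤ.+ 2) (δ (τ w) 1#) (g (wp w)))) (cong (_⊗ g (wp w)) (δ-τ-wp w))) ⟩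
      ∑[ w ] G (wp w)
        ≡⟨ ∑-wp G ⟩
      ∑[ s ] ((1ℤ ⊕ e s) ⊗ G s)
        ≡⟨ ∑-cong even ⟩
      ∑[ s ] (ℤ.+ 2 ⊗ (ι s ⊗ g s ⊖ ι s ⊗ (eₙ s ⊗ g s)))
        ≡⟨ ∑-*ˡ (ℤ.+ 2) (λ s → ι s ⊗ g s ⊖ ι s ⊗ (eₙ s ⊗ g s)) ⟩
      ℤ.+ 2 ⊗ ∑[ s ] (ι s ⊗ g s ⊖ ι s ⊗ (eₙ s ⊗ g s))
        ≡⟨ cong (ℤ.+ 2 ⊗_) (∑-- (λ s → ι s ⊗ g s) (λ s → ι s ⊗ (eₙ s ⊗ g s))) ⟩
      ℤ.+ 2 ⊗ (∑[ s ] (ι s ⊗ g s) ⊖ ∑[ s ] (ι s ⊗ (eₙ s ⊗ g s)))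
        ≡⟨ cong (ℤ.+ 2 ⊗_) (cong₂ _⊖_ ∑-ι-eₙ-inv (sym Kloosterman-²)) ⟩
      ℤ.+ 2 ⊗ (0ℤ ⊖ Kloosterman (N * N))
        ≡⟨ cong (ℤ.+ 2 ⊗_) (ℤ.+-identityˡ _) ⟩
      ℤ.+ 2 ⊗ (ℤ.- Kloosterman (N * N)) ∎)
      where
      G : Carrier → ℤ
      G s = ι s ⊗ (1ℤ ⊖ eₙ s) ⊗ g s
      -- `G` vanishes outside F_q, and on F_q the character `e` is 1, so 1 + e(s) may be replaced by
      -- 2.
      even : ∀ s → (1ℤ ⊕ e s) ⊗ G s ≡ ℤ.+ 2 ⊗ (ι s ⊗ g s ⊖ ι s ⊗ (eₙ s ⊗ g s))
      even s = begin
        (1ℤ ⊕ e s) ⊗ (ι s ⊗ (1ℤ ⊖ eₙ s) ⊗ g s)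
          ≡⟨ ℤ-solve 4 (λ e i t g → (ℤ-con 1ℤ ⟨+⟩ e) ⟨*⟩ (i ⟨*⟩ (ℤ-con 1ℤ ⟨-⟩ t) ⟨*⟩ g) ⟨=⟩ i ⟨*⟩ (ℤ-con 1ℤ ⟨+⟩ e) ⟨*⟩ ((ℤ-con 1ℤ ⟨-⟩ t) ⟨*⟩ g)) refl (e s) (ι s) (eₙ s) (g s) ⟩
        ι s ⊗ (1ℤ ⊕ e s) ⊗ ((1ℤ ⊖ eₙ s) ⊗ g s)
          ≡⟨ cong (_⊗ ((1ℤ ⊖ eₙ s) ⊗ g s)) (δ-cong {conj s} {s} {1ℤ ⊕ e s} {ℤ.+ 2} (λ p → cong (1ℤ ⊕_) (e-Fq p))) ⟩
        ι s ⊗ ℤ.+ 2 ⊗ ((1ℤ ⊖ eₙ s) ⊗ g s)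
          ≡⟨ ℤ-solve 3 (λ i t g → i ⟨*⟩ ℤ-con (ℤ.+ 2) ⟨*⟩ ((ℤ-con 1ℤ ⟨-⟩ t) ⟨*⟩ g) ⟨=⟩ ℤ-con (ℤ.+ 2) ⟨*⟩ (i ⟨*⟩ g ⟨-⟩ i ⟨*⟩ (t ⟨*⟩ g))) refl (ι s) (eₙ s) (g s) ⟩
        ℤ.+ 2 ⊗ (ι s ⊗ g s ⊖ ι s ⊗ (eₙ s ⊗ g s)) ∎

  ν-* : ∀ {v} → v ≢ 0# → ∀ x → ν (v * x) ≡ ν x
  ν-* {v} h x = cong (1ℤ ⊖_) (δ-⇔ to (λ p → trans (cong (v *_) p) (zeroʳ v)))
    where
    to : v * x ≡ 0# → x ≡ 0#
    to p = *-cancel v h (trans p (sym (zeroʳ v)))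

  τ≡1⇒≢0 : ∀ {w} → τ w ≡ 1# → w ≢ 0#
  τ≡1⇒≢0 p refl = 1≢0 (trans (sym p) (InFq⇒τ≡0 InFq-0))

  τ≡1⇒conj : ∀ {w} → τ w ≡ 1# → conj w ≡ w + 1#
  τ≡1⇒conj {w} p = trans (solve 2 (λ w v → v := w :+ (w :+ v)) refl w (conj w)) (cong (w +_) p)

  -- The representative 1 contributes e(N) = 1. If τ(w) = 1 then conj(w)/w = 1 + 1/w, where the
  -- summand 1 is invisible to `e`, and τ(1/w) = τ(w)/(w·conj w) = 1/(w² + w). This reduces the
  -- remaining sum to `∑₁-Kloosterman`.
  circle-norm : ∀ N → InFq N → N ≢ 0# →
                ∑[ y ] (ν y ⊗ e (N * (conj y * inv y))) ≡ (Q ⊖ 1ℤ) ⊗ (1ℤ ⊖ Kloosterman (N * N))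
  circle-norm N N∈Fq N≢0 = trans (∑-projective f hom)
    (cong ((Q ⊖ 1ℤ) ⊗_) (cong₂ _⊕_ f1 (trans (∑₁-cong f-wp) (∑₁-Kloosterman N N∈Fq N≢0))))
    where
    f : Carrier → ℤ
    f y = e (N * (conj y * inv y))
    hom : Homogeneous f
    hom v x p h = cong (λ z → e (N * z)) (begin
      conj (v * x) * inv (v * x)            ≡⟨ cong₂ _*_ (trans (conj-* v x) (cong (_* conj x) p)) (inv-* v x) ⟩
      (v * conj x) * (inv v * inv x)        ≡⟨ solve 4 (λ a b c d → (a :* b) :* (c :* d) := a :* (c :* (b :* d))) refl v (conj x) (inv v) (inv x) ⟩
      v * (inv v * (conj x * inv x))        ≡⟨ *-inv-cancelʳ v _ h ⟩
      conj x * inv x                        ∎)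
    f1 : f 1# ≡ 1ℤ
    f1 = e-Fq (InFq-* N∈Fq (InFq-* (cong conj conj-1) (InFq-inv InFq-1)))
    f-wp : ∀ w → τ w ≡ 1# → f w ≡ eₙ (N * inv (wp w))
    f-wp w p = begin
      e (N * (conj w * inv w))            ≡⟨ cong (λ z → e (N * (z * inv w))) w̄ ⟩
      e (N * ((w + 1#) * inv w))          ≡⟨ cong e (solve 3 (λ N w i → N :* ((w :+ con true) :* i) := N :* (w :* i) :+ N :* i) refl N w (inv w)) ⟩
      e (N * (w * inv w) + N * inv w)     ≡⟨ cong (λ z → e (N * z + N * inv w)) (inv-r w w≢0) ⟩
      e (N * 1# + N * inv w)              ≡⟨ e-+ _ _ ⟩
      e (N * 1#) ⊗ e (N * inv w)          ≡⟨ cong (_⊗ e (N * inv w)) (e-Fq (InFq-* N∈Fq InFq-1)) ⟩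
      1ℤ ⊗ e (N * inv w)                  ≡⟨ ℤ.*-identityˡ _ ⟩
      e (N * inv w)                       ≡⟨ e-τ _ ⟩
      eₙ (τ (N * inv w))                  ≡⟨ cong eₙ (trans (τ-* (inv w) N∈Fq) (cong (N *_) (sym (inv-unique τ-inv)))) ⟩
      eₙ (N * inv (wp w))                 ∎
      where
      w≢0 = τ≡1⇒≢0 p
      w̄ = τ≡1⇒conj p
      τ-inv : wp w * τ (inv w) ≡ 1#
      τ-inv = begin
        (w * w + w) * (inv w + conj (inv w))
          ≡⟨ cong₂ (λ a b → a * (inv w + b)) (trans (solve 1 (λ w → w :* w :+ w := w :* (w :+ con true)) refl w) (cong (w *_) (sym w̄))) (conj-inv w) ⟩
        (w * conj w) * (inv w + inv (conj w))
          ≡⟨ solve 4 (λ w v i j → (w :* v) :* (i :+ j) := v :* (w :* i) :+ w :* (v :* j)) refl w (conj w) (inv w) (inv (conj w)) ⟩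
        conj w * (w * inv w) + w * (conj w * inv (conj w))
          ≡⟨ cong₂ (λ a b → conj w * a + w * b) (inv-r w w≢0) (inv-r (conj w) (conj-≢0 w≢0)) ⟩
        conj w * 1# + w * 1#
          ≡⟨ solve 2 (λ w v → v :* con true :+ w :* con true := w :+ v) refl w (conj w) ⟩
        τ w
          ≡⟨ p ⟩
        1# ∎

  -- Substituting y ↦ γy with γ² = c replaces c by the norm of γ.
  circle : ∀ c → c ≢ 0# → ∑[ y ] (ν y ⊗ e (c * (conj y * inv y))) ≡ (Q ⊖ 1ℤ) ⊗ (1ℤ ⊖ Kloosterman (c * conj c))
  circle c c≢0 = begin
    ∑[ y ] (ν y ⊗ e (c * (conj y * inv y)))
      ≡⟨ ∑-scale γ γ≢0 (λ y → ν y ⊗ e (c * (conj y * inv y))) ⟩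
    ∑[ y ] (ν (γ * y) ⊗ e (c * (conj (γ * y) * inv (γ * y))))
      ≡⟨ ∑-cong (λ y → cong₂ _⊗_ (ν-* γ≢0 y) (cong e (arg y))) ⟩
    ∑[ y ] (ν y ⊗ e (N * (conj y * inv y)))
      ≡⟨ circle-norm N (InFq-norm γ) (x*y≢0 γ≢0 (conj-≢0 γ≢0)) ⟩
    (Q ⊖ 1ℤ) ⊗ (1ℤ ⊖ Kloosterman (N * N))
      ≡⟨ cong (λ z → (Q ⊖ 1ℤ) ⊗ (1ℤ ⊖ Kloosterman z)) N² ⟩
    (Q ⊖ 1ℤ) ⊗ (1ℤ ⊖ Kloosterman (c * conj c)) ∎
    where
    γ = sqrt c
    N = γ * conj γ
    γ≢0 : γ ≢ 0#
    γ≢0 p = c≢0 (trans (sym (sqrt² c)) (trans (cong (λ z → z * z) p) (zeroˡ 0#)))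
    N² : N * N ≡ c * conj c
    N² = begin
      (γ * conj γ) * (γ * conj γ)    ≡⟨ solve 2 (λ a b → (a :* b) :* (a :* b) := (a :* a) :* (b :* b)) refl γ (conj γ) ⟩
      (γ * γ) * (conj γ * conj γ)    ≡⟨ cong ((γ * γ) *_) (sym (conj-* γ γ)) ⟩
      (γ * γ) * conj (γ * γ)         ≡⟨ cong (λ z → z * conj z) (sqrt² c) ⟩
      c * conj c                     ∎
    arg : ∀ y → c * (conj (γ * y) * inv (γ * y)) ≡ N * (conj y * inv y)
    arg y = begin
      c * (conj (γ * y) * inv (γ * y))
        ≡⟨ cong₂ (λ a b → a * b) (sym (sqrt² c)) (cong₂ _*_ (conj-* γ y) (inv-* γ y)) ⟩
      (γ * γ) * ((conj γ * conj y) * (inv γ * inv y))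
        ≡⟨ solve 5 (λ g h v i j → (g :* g) :* ((h :* v) :* (i :* j)) := g :* (i :* ((g :* h) :* (v :* j)))) refl γ (conj γ) (conj y) (inv γ) (inv y) ⟩
      γ * (inv γ * (N * (conj y * inv y)))
        ≡⟨ *-inv-cancelʳ γ _ γ≢0 ⟩
      N * (conj y * inv y) ∎

  -- Evaluation of S(b, a) on and off the unit circle.

  private
    1+[q-1]≡q : suc (q ℕ.∸ 1) ≡ q
    1+[q-1]≡q = ℕ.m+[n∸m]≡n (ℕ.m^n>0 2 n)

  pw : Carrier → Carrier
  pw x = x ^ (q ℕ.∸ 1)

  x*pw : ∀ x → x * pw x ≡ conj x
  x*pw x = cong (x ^_) 1+[q-1]≡q

  pw-≢0 : ∀ {x} → x ≢ 0# → pw x ≡ conj x * inv x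
  pw-≢0 {x} h = *-cancel x h (trans (x*pw x)
    (sym (trans (solve 3 (λ x c i → x :* (c :* i) := c :* (x :* i)) refl x (conj x) (inv x))
      (trans (cong (conj x *_) (inv-r x h)) (*-identityʳ _)))))

  pw-Fq : ∀ {v} → InFq v → v ≢ 0# → pw v ≡ 1#
  pw-Fq {v} p h = *-cancel v h (trans (x*pw v) (trans p (sym (*-identityʳ v))))

  -- The zeroth power of 0 is 1 here, so the exponent q - 1 has to be shown positive.
  pw-0 : pw 0# ≡ 0#
  pw-0 = 0^ (q ℕ.∸ 1) {{ℕ.>-nonZero (ℕ.m<n⇒0<n∸m (ℕ.^-monoʳ-< 2 (ℕ.s≤s (ℕ.s≤s ℕ.z≤n)) {0} {n} (ℕ.s≤s ℕ.z≤n)))}}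

  fa-hom : ∀ b a v x → InFq v → v ≢ 0# → fa b a (v * x) ≡ fa b a x
  fa-hom b a v x p h = cong (λ z → Tr2n (a / (z + b)))
    (trans (*-^ v x (q ℕ.∸ 1)) (trans (cong (_* pw x) (pw-Fq p h)) (*-identityˡ _)))

  S : Carrier → Carrier → ℤ
  S b a = ∑[ x ] (ν x ⊗ sgn (fa b a x))

  -- The fibre τ = 1 is the coset w₀ + F_q; the translation contributes the factor e(a·w₀).
  ∑₁-e : ∀ a → ∑₁ (λ w → e (a * w)) ≡ Q ⊗ (ι a ⊗ e (a * w₀))
  ∑₁-e a = begin
    ∑[ w ] (δ (τ w) 1# ⊗ e (a * w))
      ≡⟨ ∑-translate w₀ (λ w → δ (τ w) 1# ⊗ e (a * w)) ⟩
    ∑[ y ] (δ (τ (y + w₀)) 1# ⊗ e (a * (y + w₀)))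
      ≡⟨ ∑-cong (λ y → cong₂ _⊗_ (δ-⇔ (to y) (from y)) (trans (cong e (distribˡ a y w₀)) (e-+ _ _))) ⟩
    ∑[ y ] (ι y ⊗ (e (a * y) ⊗ e (a * w₀)))
      ≡⟨ ∑-cong (λ y → sym (ℤ.*-assoc (ι y) (e (a * y)) (e (a * w₀)))) ⟩
    ∑[ y ] (ι y ⊗ e (a * y) ⊗ e (a * w₀))
      ≡⟨ ∑-*ʳ (λ y → ι y ⊗ e (a * y)) (e (a * w₀)) ⟩
    ∑[ y ] (ι y ⊗ e (a * y)) ⊗ e (a * w₀)
      ≡⟨ cong (_⊗ e (a * w₀)) (Fq-orthogonality a) ⟩
    Q ⊗ ι a ⊗ e (a * w₀)
      ≡⟨ ℤ.*-assoc Q (ι a) (e (a * w₀)) ⟩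
    Q ⊗ (ι a ⊗ e (a * w₀)) ∎
    where
    τ-shift : ∀ y → τ (y + w₀) ≡ τ y + 1#
    τ-shift y = trans (τ-+ y w₀) (cong (τ y +_) τ-w₀)
    to : ∀ y → τ (y + w₀) ≡ 1# → InFq y
    to y p = τ≡0⇒InFq (trans (sym (+-involutive (τ y) 1#)) (x≡y⇒x+y≡0 (trans (sym (τ-shift y)) p)))
    from : ∀ y → InFq y → τ (y + w₀) ≡ 1#
    from y p = trans (τ-shift y) (trans (cong (_+ 1#) (InFq⇒τ≡0 p)) (+-identityˡ 1#))

  -- At x = 1 the denominator is 1 + 1 = 0, so the convention a/0 = 0 yields the value 1. On the
  -- fibre τ = 1 the reciprocal of w^(q-1) + 1 is w, which leaves the linear sum `∑₁-e`.
  S-1 : ∀ a → S 1# a ≡ (Q ⊖ 1ℤ) ⊗ (1ℤ ⊕ Q ⊗ (ι a ⊗ e (a * w₀)))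
  S-1 a = trans (∑-projective (λ x → sgn (fa 1# a x)) (λ v x p h → cong sgn (fa-hom 1# a v x p h)))
    (cong ((Q ⊖ 1ℤ) ⊗_) (cong₂ _⊕_ at1 (trans (∑₁-cong atw) (∑₁-e a))))
    where
    at1 : sgn (fa 1# a 1#) ≡ 1ℤ
    at1 = trans (cong e (trans (cong (λ z → a * inv (z + 1#)) (1^ (q ℕ.∸ 1)))
      (trans (cong (λ z → a * inv z) char2) (trans (cong (a *_) inv-0) (zeroʳ a))))) e-0
    atw : ∀ w → τ w ≡ 1# → sgn (fa 1# a w) ≡ e (a * w)
    atw w p = cong (λ z → e (a * z)) (begin
      inv (pw w + 1#)       ≡⟨ inv-unique (begin
        (pw w + 1#) * w       ≡⟨ solve 2 (λ p w → (p :+ con true) :* w := w :+ w :* p) refl (pw w) w ⟩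
        w + w * pw w          ≡⟨ cong (w +_) (x*pw w) ⟩
        τ w                   ≡⟨ p ⟩
        1#                    ∎) ⟩
      w ∎)

  S-InFq : ∀ {a} → InFq a → S 1# a ≡ (Q ⊖ 1ℤ) ⊗ (1ℤ ⊕ Q ⊗ eₙ a)
  S-InFq {a} p = trans (S-1 a) (cong (λ z → (Q ⊖ 1ℤ) ⊗ (1ℤ ⊕ Q ⊗ z)) (begin
    ι a ⊗ e (a * w₀)   ≡⟨ cong₂ _⊗_ (ι-InFq p) (trans (cong e (*-comm a w₀)) (e-w₀ p)) ⟩
    1ℤ ⊗ eₙ a          ≡⟨ ℤ.*-identityˡ _ ⟩
    eₙ a               ∎))

  S-∉Fq : ∀ {a} → ¬ InFq a → S 1# a ≡ (Q ⊖ 1ℤ) ⊗ 1ℤ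
  S-∉Fq {a} h = trans (S-1 a) (cong (λ z → (Q ⊖ 1ℤ) ⊗ (1ℤ ⊕ z)) (begin
    Q ⊗ (ι a ⊗ e (a * w₀))   ≡⟨ cong (λ i → Q ⊗ (i ⊗ e (a * w₀))) (ι-∉Fq h) ⟩
    Q ⊗ (0ℤ ⊗ e (a * w₀))    ≡⟨ cong (Q ⊗_) (ℤ.*-zeroˡ (e (a * w₀))) ⟩
    Q ⊗ 0ℤ                   ≡⟨ ℤ.*-zeroʳ Q ⟩
    0ℤ                       ∎))

  -- With β = 1 + b one has β^(q−1) = conj b, so the substitution x ↦ x/β reduces b ∈ U to b = 1.
  S-U : ∀ b a → b * conj b ≡ 1# → S b a ≡ S 1# (a * conj b)
  S-U b a bb̄ with b ≟ 1#
  -- For b = 1 the scalar `β` is 0 and cannot be used, but both sums already agree.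
  ... | yes refl = cong (S 1#) (sym (trans (cong (a *_) conj-1) (*-identityʳ a)))
  ... | no h = trans (∑-scale (inv β) (inv-≢0 β≢0) (λ x → ν x ⊗ sgn (fa b a x)))
      (∑-cong (λ y → cong₂ _⊗_ (ν-* (inv-≢0 β≢0) y) (cong e (arg y))))
    where
    β = 1# + b
    β≢0 : β ≢ 0#
    β≢0 p = h (sym (x+y≡0⇒x≡y p))
    pw-β : pw (inv β) ≡ b
    pw-β = begin
      pw (inv β)                      ≡⟨ pw-≢0 (inv-≢0 β≢0) ⟩
      conj (inv β) * inv (inv β)      ≡⟨ cong₂ _*_ (conj-inv β) (inv-involutive β) ⟩
      inv (conj β) * β                ≡⟨ cong (λ z → inv z * β) conj-β ⟩
      inv (conj b * β) * β            ≡⟨ cong (_* β) (inv-* (conj b) β) ⟩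
      (inv (conj b) * inv β) * β      ≡⟨ trans (*-assoc _ _ _) (trans (cong (inv (conj b) *_) (inv-l β β≢0)) (*-identityʳ _)) ⟩
      inv (conj b)                    ≡⟨ inv-unique (trans (*-comm _ _) bb̄) ⟩
      b                               ∎
      where
      conj-β : conj β ≡ conj b * β
      conj-β = begin
        conj (1# + b)            ≡⟨ trans (conj-+ 1# b) (cong (_+ conj b) (trans conj-1 (sym bb̄))) ⟩
        b * conj b + conj b      ≡⟨ solve 2 (λ b c → b :* c :+ c := c :* (con true :+ b)) refl b (conj b) ⟩
        conj b * β               ∎
    arg : ∀ y → a / (pw (inv β * y) + b) ≡ (a * conj b) / (pw y + 1#)
    arg y = begin
      a * inv (pw (inv β * y) + b)         ≡⟨ cong (λ z → a * inv (z + b)) (trans (*-^ (inv β) y (q ℕ.∸ 1)) (cong (_* pw y) pw-β)) ⟩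
      a * inv (b * pw y + b)               ≡⟨ cong (λ z → a * inv z) (solve 2 (λ b p → b :* p :+ b := b :* (p :+ con true)) refl b (pw y)) ⟩
      a * inv (b * (pw y + 1#))            ≡⟨ cong (a *_) (trans (inv-* b _) (cong (_* inv (pw y + 1#)) (inv-unique bb̄))) ⟩
      a * (conj b * inv (pw y + 1#))       ≡⟨ sym (*-assoc _ _ _) ⟩
      (a * conj b) * inv (pw y + 1#)       ∎

  -- The substitution y = conj x + b x moves the circle η ↦ 1/(η + b) to the origin; d = 1 + b conj b.
  S-∉U : ∀ b a → b * conj b ≢ 1# → a ≢ 0# → S b a ≡ (Q ⊖ 1ℤ) ⊗ (sgn (ufun b a) ⊗ (1ℤ ⊖ kfun b a))
  S-∉U b a bb̄≢1 a≢0 = begin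
    ∑[ x ] (ν x ⊗ sgn (fa b a x))
      ≡⟨ ∑-cong (λ x → ν-cong {x} (arg x)) ⟩
    ∑[ x ] (ν x ⊗ (u ⊗ h (L x)))
      ≡⟨ ∑-cong (λ x → trans (cong (_⊗ (u ⊗ h (L x))) (ν-L x)) (ℤ-solve 3 (λ a b c → a ⟨*⟩ (b ⟨*⟩ c) ⟨=⟩ b ⟨*⟩ (a ⟨*⟩ c)) refl (ν (L x)) u (h (L x)))) ⟩
    ∑[ x ] (u ⊗ (ν (L x) ⊗ h (L x)))
      ≡⟨ ∑-*ˡ u (λ x → ν (L x) ⊗ h (L x)) ⟩
    u ⊗ ∑[ x ] (ν (L x) ⊗ h (L x))
      ≡⟨ cong (u ⊗_) (trans (sym (∑-bijection L L⁻¹ L∘L⁻¹ L⁻¹∘L (λ y → ν y ⊗ h y))) (circle c (x*y≢0 a≢0 (inv-≢0 d≢0)))) ⟩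
    u ⊗ ((Q ⊖ 1ℤ) ⊗ (1ℤ ⊖ Kloosterman (c * conj c)))
      ≡⟨ cong (λ z → u ⊗ ((Q ⊖ 1ℤ) ⊗ (1ℤ ⊖ Kloosterman z))) cc̄ ⟩
    u ⊗ ((Q ⊖ 1ℤ) ⊗ (1ℤ ⊖ kfun b a))
      ≡⟨ ℤ-solve 3 (λ a b c → a ⟨*⟩ (b ⟨*⟩ c) ⟨=⟩ b ⟨*⟩ (a ⟨*⟩ c)) refl u (Q ⊖ 1ℤ) (1ℤ ⊖ kfun b a) ⟩
    (Q ⊖ 1ℤ) ⊗ (u ⊗ (1ℤ ⊖ kfun b a)) ∎
    where
    b̄ = conj b
    d = 1# + b * b̄
    c = a * inv d
    u = sgn (ufun b a)
    h : Carrier → ℤ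
    h y = e (c * (conj y * inv y))
    d≢0 : d ≢ 0#
    d≢0 p = bb̄≢1 (sym (x+y≡0⇒x≡y p))
    d∈Fq : InFq d
    d∈Fq = InFq-+ InFq-1 (InFq-norm b)
    -- With y = conj x + b x, the combination conj y + conj(b) y eliminates conj x and equals d·x.
    -- This is the origin of `L⁻¹`, and d ≠ 0 is exactly b ∉ U.
    L L⁻¹ : Carrier → Carrier
    L x = conj x + b * x
    L⁻¹ y = (conj y + b̄ * y) * inv d
    conj-L : ∀ x → conj (L x) ≡ x + b̄ * conj x
    conj-L x = trans (conj-+ _ _) (cong₂ _+_ (conj-conj x) (conj-* b x))
    L⁻¹∘L : ∀ x → L⁻¹ (L x) ≡ x
    L⁻¹∘L x = begin
      (conj (L x) + b̄ * L x) * inv d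
        ≡⟨ cong (λ z → (z + b̄ * L x) * inv d) (conj-L x) ⟩
      ((x + b̄ * conj x) + b̄ * (conj x + b * x)) * inv d
        ≡⟨ solve 5 (λ x y b c i → ((x :+ c :* y) :+ c :* (y :+ b :* x)) :* i := (con true :+ b :* c) :* (i :* x)) refl x (conj x) b b̄ (inv d) ⟩
      d * (inv d * x)
        ≡⟨ *-inv-cancelʳ d x d≢0 ⟩
      x ∎
    L∘L⁻¹ : ∀ y → L (L⁻¹ y) ≡ y
    L∘L⁻¹ y = begin
      conj ((conj y + b̄ * y) * inv d) + b * L⁻¹ y
        ≡⟨ cong (_+ b * L⁻¹ y) (trans (conj-* _ _) (cong₂ _*_ (trans (conj-+ _ _) (cong₂ _+_ (conj-conj y) (trans (conj-* b̄ y) (cong (_* conj y) (conj-conj b))))) (InFq-inv d∈Fq))) ⟩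
      (y + b * conj y) * inv d + b * ((conj y + b̄ * y) * inv d)
        ≡⟨ solve 5 (λ y z b c i → (y :+ b :* z) :* i :+ b :* ((z :+ c :* y) :* i) := (con true :+ b :* c) :* (i :* y)) refl y (conj y) b b̄ (inv d) ⟩
      d * (inv d * y)
        ≡⟨ *-inv-cancelʳ d y d≢0 ⟩
      y ∎
    L-0 : L 0# ≡ 0#
    L-0 = trans (cong₂ _+_ conj-0 (zeroʳ b)) (+-identityˡ 0#)
    L≡0 : ∀ x → L x ≡ 0# → x ≡ 0#
    L≡0 x p = trans (sym (L⁻¹∘L x)) (trans (cong L⁻¹ (trans p (sym L-0))) (L⁻¹∘L 0#))
    ν-L : ∀ x → ν x ≡ ν (L x)
    ν-L x = cong (1ℤ ⊖_) (δ-⇔ (λ p → trans (cong L p) L-0) (L≡0 x))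
    e-u : e (a * b̄ * inv d) ≡ u
    e-u = trans (sym (e-conj _)) (cong e (trans (conj-* _ _)
      (cong₂ _*_ (trans (conj-* a b̄) (cong (conj a *_) (conj-conj b))) (InFq-inv d∈Fq))))
    -- For y = L(x) one has 1/(x^(q-1) + b) = x/y = (conj(y)/y + conj b)/d. The constant part
    -- a·conj(b)/d is conjugate to the argument of `ufun`, so it contributes the sign `u`; the other
    -- part is the circle sum with c = a/d.
    arg : ∀ x → x ≢ 0# → sgn (fa b a x) ≡ u ⊗ h (L x)
    arg x x≢0 = begin
      e (a * inv (pw x + b))                                 ≡⟨ cong (λ z → e (a * z)) (trans (cong inv pw+b) (trans (inv-* (L x) (inv x)) (cong (inv (L x) *_) (inv-involutive x)))) ⟩
      e (a * (inv (L x) * x))                                ≡⟨ cong (λ z → e (a * (inv (L x) * z))) (sym (L⁻¹∘L x)) ⟩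
      e (a * (inv (L x) * ((conj (L x) + b̄ * L x) * inv d))) ≡⟨ cong e (solve 6 (λ a j y v b i → a :* (j :* ((v :+ b :* y) :* i)) := a :* b :* i :* (y :* j) :+ (a :* i) :* (v :* j)) refl a (inv (L x)) (L x) (conj (L x)) b̄ (inv d)) ⟩
      e (a * b̄ * inv d * (L x * inv (L x)) + c * (conj (L x) * inv (L x)))
                                                             ≡⟨ cong (λ z → e (z + c * (conj (L x) * inv (L x)))) (trans (cong (a * b̄ * inv d *_) (inv-r (L x) (x≢0 ∘ L≡0 x))) (*-identityʳ _)) ⟩
      e (a * b̄ * inv d + c * (conj (L x) * inv (L x)))       ≡⟨ e-+ _ _ ⟩
      e (a * b̄ * inv d) ⊗ h (L x)                            ≡⟨ cong (_⊗ h (L x)) e-u ⟩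
      u ⊗ h (L x)                                            ∎
      where
      pw+b : pw x + b ≡ L x * inv x
      pw+b = begin
        pw x + b                          ≡⟨ cong (_+ b) (pw-≢0 x≢0) ⟩
        conj x * inv x + b                ≡⟨ cong (conj x * inv x +_) (sym (trans (cong (b *_) (inv-r x x≢0)) (*-identityʳ b))) ⟩
        conj x * inv x + b * (x * inv x)  ≡⟨ solve 4 (λ v i b x → v :* i :+ b :* (x :* i) := (v :+ b :* x) :* i) refl (conj x) (inv x) b x ⟩
        L x * inv x                       ∎
    cc̄ : c * conj c ≡ (a * conj a) / (1# + (b * b) * (b̄ * b̄))
    cc̄ = begin
      (a * inv d) * conj (a * inv d)         ≡⟨ cong ((a * inv d) *_) (trans (conj-* a (inv d)) (cong (conj a *_) (InFq-inv d∈Fq))) ⟩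
      (a * inv d) * (conj a * inv d)         ≡⟨ solve 3 (λ a v i → (a :* i) :* (v :* i) := (a :* v) :* (i :* i)) refl a (conj a) (inv d) ⟩
      (a * conj a) * (inv d * inv d)         ≡⟨ cong ((a * conj a) *_) (sym (inv-* d d)) ⟩
      (a * conj a) * inv (d * d)             ≡⟨ cong (λ z → (a * conj a) * inv z) (solve 2 (λ b c → (con true :+ b :* c) :* (con true :+ b :* c) := con true :+ (b :* b) :* (c :* c)) refl b b̄) ⟩
      (a * conj a) * inv (1# + (b * b) * (b̄ * b̄)) ∎

-- The majority identity and the six conditions.

module Majority (k : ℕ) (F : GF2^ (2 ℕ.* suc k)) where
  open QuadraticExtension k F
  open ExponentialSums k F
  open Setting n F
  open FieldTheory F
  open Solver₂ using (solve; _:+_; _:*_; _:=_; con)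
  open Sums F
  open Traces F
  open Characters F

  -- On bits this is the majority vote, and h₃ is the majority of f₁, f₂, f₃.
  maj : Carrier → Carrier → Carrier → Carrier
  maj x y z = x * y + x * z + y * z

  private
    sgn₂ : Bool → ℤ
    sgn₂ false = 1ℤ
    sgn₂ true  = ℤ.- 1ℤ

    sgn-emb : ∀ i → sgn (emb i) ≡ sgn₂ i
    sgn-emb false = sgn-0
    sgn-emb true  = sgn-1

    Bit⇒emb : ∀ {x} → Bit x → ∃ λ i → x ≡ emb i
    Bit⇒emb (inj₁ p) = false , p
    Bit⇒emb (inj₂ p) = true , p

    maj₂ sum₂ : Bool → Bool → Bool → Bool
    maj₂ i j l = ((i ∧ j) xor (i ∧ l)) xor (j ∧ l)
    sum₂ i j l = (i xor j) xor l

    maj-emb : ∀ i j l → maj (emb i) (emb j) (emb l) ≡ emb (maj₂ i j l)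
    maj-emb i j l = sym (trans (emb-+ ((i ∧ j) xor (i ∧ l)) (j ∧ l)) (cong₂ _+_
      (trans (emb-+ (i ∧ j) (i ∧ l)) (cong₂ _+_ (emb-* i j) (emb-* i l))) (emb-* j l)))

    sum-emb : ∀ i j l → emb i + emb j + emb l ≡ emb (sum₂ i j l)
    sum-emb i j l = sym (trans (emb-+ (i xor j) l) (cong (_+ emb l) (emb-+ i j)))

    -- Over `Bool` all eight cases hold by computation; `emb` carries the identity into the abstract
    -- field.
    sgn₂-maj : ∀ i j l → ℤ.+ 2 ⊗ sgn₂ (maj₂ i j l) ≡ (sgn₂ i ⊕ sgn₂ j ⊕ sgn₂ l) ⊖ sgn₂ (sum₂ i j l)
    sgn₂-maj false false false = refl
    sgn₂-maj false false true  = refl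
    sgn₂-maj false true  false = refl
    sgn₂-maj false true  true  = refl
    sgn₂-maj true  false false = refl
    sgn₂-maj true  false true  = refl
    sgn₂-maj true  true  false = refl
    sgn₂-maj true  true  true  = refl

  Bit-maj : ∀ {x y z} → Bit x → Bit y → Bit z → Bit (maj x y z)
  Bit-maj p q r with Bit⇒emb p | Bit⇒emb q | Bit⇒emb r
  ... | i , refl | j , refl | l , refl = subst Bit (sym (maj-emb i j l)) (Bit-emb (maj₂ i j l))
    where
    Bit-emb : ∀ i → Bit (emb i)
    Bit-emb false = inj₁ refl
    Bit-emb true  = inj₂ refl

  sgn-maj : ∀ {x y z} → Bit x → Bit y → Bit z →
            ℤ.+ 2 ⊗ sgn (maj x y z) ≡ (sgn x ⊕ sgn y ⊕ sgn z) ⊖ sgn (x + y + z)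
  sgn-maj p q r with Bit⇒emb p | Bit⇒emb q | Bit⇒emb r
  ... | i , refl | j , refl | l , refl = begin
    ℤ.+ 2 ⊗ sgn (maj (emb i) (emb j) (emb l))
      ≡⟨ cong (ℤ.+ 2 ⊗_) (trans (cong sgn (maj-emb i j l)) (sgn-emb (maj₂ i j l))) ⟩
    ℤ.+ 2 ⊗ sgn₂ (maj₂ i j l)
      ≡⟨ sgn₂-maj i j l ⟩
    (sgn₂ i ⊕ sgn₂ j ⊕ sgn₂ l) ⊖ sgn₂ (sum₂ i j l)
      ≡⟨ sym (cong₂ _⊖_ (cong₂ _⊕_ (cong₂ _⊕_ (sgn-emb i) (sgn-emb j)) (sgn-emb l))
                        (trans (cong sgn (sum-emb i j l)) (sgn-emb (sum₂ i j l)))) ⟩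
    (sgn (emb i) ⊕ sgn (emb j) ⊕ sgn (emb l)) ⊖ sgn (emb i + emb j + emb l) ∎

  fa-+ : ∀ b a a′ x → fa b (a + a′) x ≡ fa b a x + fa b a′ x
  fa-+ b a a′ x = trans (cong Tr2n (distribʳ _ a a′)) (T-+ (2 ℕ.* n) _ _)

  ufun-+ : ∀ b x y → ufun b (x + y) ≡ ufun b x + ufun b y
  ufun-+ b x y = trans (cong Tr2n (trans (cong (λ z → z * b * inv (1# + b * conj b)) (conj-+ x y))
      (solve 4 (λ x y b i → (x :+ y) :* b :* i := x :* b :* i :+ y :* b :* i) refl (conj x) (conj y) b (inv (1# + b * conj b)))))
    (T-+ (2 ℕ.* n) _ _)

  ¬InFq-+ : ∀ {x y} → InFq x → ¬ InFq y → ¬ InFq (x + y)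
  ¬InFq-+ {x} {y} p h r = h (subst InFq (solve 2 (λ x y → x :+ (x :+ y) := y) refl x y) (InFq-+ p r))

  sgn-opposite : ∀ x y → sgn x ⊗ sgn y ≡ ℤ.- 1ℤ → sgn y ≡ ℤ.- sgn x
  sgn-opposite x y p = begin
    sgn y                        ≡⟨ sym (ℤ.*-identityˡ _) ⟩
    1ℤ ⊗ sgn y                   ≡⟨ cong (_⊗ sgn y) (sym (sgn-² x)) ⟩
    sgn x ⊗ sgn x ⊗ sgn y        ≡⟨ ℤ.*-assoc (sgn x) (sgn x) (sgn y) ⟩
    sgn x ⊗ (sgn x ⊗ sgn y)      ≡⟨ cong (sgn x ⊗_) p ⟩
    sgn x ⊗ ℤ.- 1ℤ               ≡⟨ ℤ-solve 1 (λ x → x ⟨*⟩ (⟨-⟩ ℤ-con 1ℤ) ⟨=⟩ ⟨-⟩ x) refl (sgn x) ⟩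
    ℤ.- sgn x                    ∎

  eₙ-opposite : ∀ {x y} → InFq x → InFq y → Trn (x + y) ≡ 1# → eₙ y ≡ ℤ.- eₙ x
  eₙ-opposite {x} {y} p r h = sgn-opposite (Trn x) (Trn y) (trans (sym (eₙ-+ p r)) (trans (cong sgn h) sgn-1))

  InU⇒norm : ∀ {b} → InU b → b * conj b ≡ 1#
  InU⇒norm {b} p = trans (trans (*-comm _ _) (cong (conj b *_) (sym (*-identityʳ b)))) (trans (sym (^-+ b q 1)) p)

  norm⇒InU : ∀ {b} → b * conj b ≡ 1# → InU b
  norm⇒InU {b} p = trans (^-+ b q 1) (trans (trans (cong (conj b *_) (*-identityʳ b)) (*-comm _ _)) p)

  Trn2n-τ : ∀ x → Trn2n x ≡ τ x
  Trn2n-τ x = begin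
    (x ^ (2 ℕ.^ (n ℕ.+ 0))) + (x * 1# + 0#)   ≡⟨ cong₂ (λ i y → (x ^ (2 ℕ.^ i)) + y) (ℕ.+-identityʳ n) (trans (+-identityʳ _) (*-identityʳ x)) ⟩
    conj x + x                                ≡⟨ +-comm _ _ ⟩
    τ x                                       ∎

  Trn2n≡0⇒InFq : ∀ {x} → Trn2n x ≡ 0# → InFq x
  Trn2n≡0⇒InFq {x} p = τ≡0⇒InFq (trans (sym (Trn2n-τ x)) p)

  Trn2n≢0⇒∉Fq : ∀ {x} → Trn2n x ≢ 0# → ¬ InFq x
  Trn2n≢0⇒∉Fq {x} h p = h (trans (Trn2n-τ x) (InFq⇒τ≡0 p))

  module _ (b a₁ a₂ a₃ : Carrier) where

    -- f₁ + f₂ + f₃ is again of the form `fa b` with coefficient a₁ + a₂ + a₃, so one evaluation of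
    -- `S` serves all four terms.
    sgn-h3 : ∀ x → ℤ.+ 2 ⊗ sgn (h3 b a₁ a₂ a₃ x) ≡
      (sgn (fa b a₁ x) ⊕ sgn (fa b a₂ x) ⊕ sgn (fa b a₃ x)) ⊖ sgn (fa b (a₁ + a₂ + a₃) x)
    sgn-h3 x = trans (sgn-maj (Tr-Bit _) (Tr-Bit _) (Tr-Bit _))
      (cong (λ z → (sgn (fa b a₁ x) ⊕ sgn (fa b a₂ x) ⊕ sgn (fa b a₃ x)) ⊖ sgn z)
        (sym (trans (fa-+ b (a₁ + a₂) a₃ x) (cong (_+ fa b a₃ x) (fa-+ b a₁ a₂ x)))))

    h3-sum : ℤ.+ 2 ⊗ ∑[ x ] (ν x ⊗ sgn (h3 b a₁ a₂ a₃ x)) ≡ (S b a₁ ⊕ S b a₂ ⊕ S b a₃) ⊖ S b (a₁ + a₂ + a₃)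
    h3-sum = begin
      ℤ.+ 2 ⊗ ∑[ x ] (ν x ⊗ sgn (h3 b a₁ a₂ a₃ x))
        ≡⟨ sym (∑-*ˡ (ℤ.+ 2) (λ x → ν x ⊗ sgn (h3 b a₁ a₂ a₃ x))) ⟩
      ∑[ x ] (ℤ.+ 2 ⊗ (ν x ⊗ sgn (h3 b a₁ a₂ a₃ x)))
        ≡⟨ ∑-cong pointwise ⟩
      ∑[ x ] ((t a₁ x ⊕ t a₂ x ⊕ t a₃ x) ⊖ t s x)
        ≡⟨ ∑-- (λ x → t a₁ x ⊕ t a₂ x ⊕ t a₃ x) (t s) ⟩
      ∑[ x ] (t a₁ x ⊕ t a₂ x ⊕ t a₃ x) ⊖ S b s
        ≡⟨ cong (_⊖ S b s) (trans (∑-+ (λ x → t a₁ x ⊕ t a₂ x) (t a₃)) (cong (_⊕ S b a₃) (∑-+ (t a₁) (t a₂)))) ⟩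
      (S b a₁ ⊕ S b a₂ ⊕ S b a₃) ⊖ S b s ∎
      where
      s = a₁ + a₂ + a₃
      t : Carrier → Carrier → ℤ
      t a x = ν x ⊗ sgn (fa b a x)
      pointwise : ∀ x → ℤ.+ 2 ⊗ (ν x ⊗ sgn (h3 b a₁ a₂ a₃ x)) ≡ (t a₁ x ⊕ t a₂ x ⊕ t a₃ x) ⊖ t s x
      pointwise x = begin
        ℤ.+ 2 ⊗ (ν x ⊗ sgn (h3 b a₁ a₂ a₃ x))
          ≡⟨ ℤ-solve 2 (λ v z → ℤ-con (ℤ.+ 2) ⟨*⟩ (v ⟨*⟩ z) ⟨=⟩ v ⟨*⟩ (ℤ-con (ℤ.+ 2) ⟨*⟩ z)) refl (ν x) (sgn (h3 b a₁ a₂ a₃ x)) ⟩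
        ν x ⊗ (ℤ.+ 2 ⊗ sgn (h3 b a₁ a₂ a₃ x))
          ≡⟨ cong (ν x ⊗_) (sgn-h3 x) ⟩
        ν x ⊗ ((sgn (fa b a₁ x) ⊕ sgn (fa b a₂ x) ⊕ sgn (fa b a₃ x)) ⊖ sgn (fa b s x))
          ≡⟨ ℤ-solve 5 (λ v x y z w → v ⟨*⟩ ((x ⟨+⟩ y ⟨+⟩ z) ⟨-⟩ w) ⟨=⟩ (v ⟨*⟩ x ⟨+⟩ v ⟨*⟩ y ⟨+⟩ v ⟨*⟩ z) ⟨-⟩ v ⟨*⟩ w)
               refl (ν x) (sgn (fa b a₁ x)) (sgn (fa b a₂ x)) (sgn (fa b a₃ x)) (sgn (fa b s x)) ⟩
        (t a₁ x ⊕ t a₂ x ⊕ t a₃ x) ⊖ t s x ∎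

    -- Every value of `S` carries the factor Q - 1. Once it is pulled out, the balance condition for
    -- h₃ is a single equation between the cofactors and the sign at 0.
    h3-Bent : ∀ {c₁ c₂ c₃ c₄} →
      S b a₁ ≡ (Q ⊖ 1ℤ) ⊗ c₁ → S b a₂ ≡ (Q ⊖ 1ℤ) ⊗ c₂ → S b a₃ ≡ (Q ⊖ 1ℤ) ⊗ c₃ → S b (a₁ + a₂ + a₃) ≡ (Q ⊖ 1ℤ) ⊗ c₄ →
      ℤ.+ 2 ⊗ sgn (h3 b a₁ a₂ a₃ 0#) ≡ (c₁ ⊕ c₂ ⊕ c₃) ⊖ c₄ → Bent (h3 b a₁ a₂ a₃)
    h3-Bent {c₁} {c₂} {c₃} {c₄} p₁ p₂ p₃ p₄ r = Balanced⇒Bent (h3 b a₁ a₂ a₃)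
      (λ x → Bit-maj (Tr-Bit _) (Tr-Bit _) (Tr-Bit _)) hom
      (ℤ.*-cancelˡ-≡ (ℤ.+ 2) _ _ (begin
        ℤ.+ 2 ⊗ ∑[ x ] (ν x ⊗ sgn (h3 b a₁ a₂ a₃ x))
          ≡⟨ h3-sum ⟩
        (S b a₁ ⊕ S b a₂ ⊕ S b a₃) ⊖ S b (a₁ + a₂ + a₃)
          ≡⟨ cong₂ _⊖_ (cong₂ _⊕_ (cong₂ _⊕_ p₁ p₂) p₃) p₄ ⟩
        ((Q ⊖ 1ℤ) ⊗ c₁ ⊕ (Q ⊖ 1ℤ) ⊗ c₂ ⊕ (Q ⊖ 1ℤ) ⊗ c₃) ⊖ (Q ⊖ 1ℤ) ⊗ c₄
          ≡⟨ ℤ-solve 5 (λ v x y z w → (v ⟨*⟩ x ⟨+⟩ v ⟨*⟩ y ⟨+⟩ v ⟨*⟩ z) ⟨-⟩ v ⟨*⟩ w ⟨=⟩ v ⟨*⟩ ((x ⟨+⟩ y ⟨+⟩ z) ⟨-⟩ w)) refl (Q ⊖ 1ℤ) c₁ c₂ c₃ c₄ ⟩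
        (Q ⊖ 1ℤ) ⊗ ((c₁ ⊕ c₂ ⊕ c₃) ⊖ c₄)
          ≡⟨ cong ((Q ⊖ 1ℤ) ⊗_) (sym r) ⟩
        (Q ⊖ 1ℤ) ⊗ (ℤ.+ 2 ⊗ sgn (h3 b a₁ a₂ a₃ 0#))
          ≡⟨ ℤ-solve 2 (λ v z → v ⟨*⟩ (ℤ-con (ℤ.+ 2) ⟨*⟩ z) ⟨=⟩ ℤ-con (ℤ.+ 2) ⟨*⟩ (v ⟨*⟩ z)) refl (Q ⊖ 1ℤ) (sgn (h3 b a₁ a₂ a₃ 0#)) ⟩
        ℤ.+ 2 ⊗ ((Q ⊖ 1ℤ) ⊗ sgn (h3 b a₁ a₂ a₃ 0#)) ∎))
      where
      hom : Homogeneous (λ x → sgn (h3 b a₁ a₂ a₃ x))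
      hom v x p h = cong sgn (cong₂ _+_ (cong₂ _+_ (cong₂ _*_ f₁ f₂) (cong₂ _*_ f₁ f₃)) (cong₂ _*_ f₂ f₃))
        where
        f₁ = fa-hom b a₁ v x p h
        f₂ = fa-hom b a₂ v x p h
        f₃ = fa-hom b a₃ v x p h

    private
      s = a₁ + a₂ + a₃
      2sgn0 : h3 b a₁ a₂ a₃ 0# ≡ 0# → ℤ.+ 2 ⊗ sgn (h3 b a₁ a₂ a₃ 0#) ≡ ℤ.+ 2
      2sgn0 p = cong (ℤ.+ 2 ⊗_) (trans (cong sgn p) sgn-0)

    -- At x = 0 the denominator is 0 + 1, so f_i(0) = Tr(a_i). Two of the three votes are 0: the
    -- first because a₁ ∈ F_q, the second by assumption.
    h3-0 : b ≡ 1# → InFq a₁ → Tr2n a₂ ≡ 0# → h3 b a₁ a₂ a₃ 0# ≡ 0#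
    h3-0 refl p r = trans (cong₂ (λ x y → x * y + x * z + y * z) (trans (fa-0 a₁) (Tr2n-Fq p)) (trans (fa-0 a₂) r))
      (solve 1 (λ z → con false :* con false :+ con false :* z :+ con false :* z := con false) refl z)
      where
      z = fa 1# a₃ 0#
      fa-0 : ∀ a → fa 1# a 0# ≡ Tr2n a
      fa-0 a = cong Tr2n (trans (cong (λ z → a * inv z) (trans (cong (_+ 1#) pw-0) (+-identityˡ 1#)))
        (trans (cong (a *_) inv-1) (*-identityʳ a)))

    module _ (a₁∈Fq : InFq a₁) (a₁≢0 : a₁ ≢ 0#) where

      -- Only a₁ and a₂ lie in F_q. Their terms in Q have opposite signs because Tr_n(a₁ + a₂) = 1,
      -- so the cofactors combine to 2.
      bent₁ : Cond1 b a₁ a₂ a₃ → Bent (h3 b a₁ a₂ a₃)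
      bent₁ (refl , (a₂∈Fq , _) , a₃∉Fq , tr) =
        h3-Bent (S-InFq a₁∈Fq) (S-InFq a₂∈Fq) (S-∉Fq a₃∉Fq) (S-∉Fq (¬InFq-+ (InFq-+ a₁∈Fq a₂∈Fq) a₃∉Fq))
          (trans (2sgn0 (h3-0 refl a₁∈Fq (Tr2n-Fq a₂∈Fq))) (sym (trans
            (cong (λ z → ((1ℤ ⊕ Q ⊗ eₙ a₁) ⊕ (1ℤ ⊕ Q ⊗ z) ⊕ 1ℤ) ⊖ 1ℤ) (eₙ-opposite a₁∈Fq a₂∈Fq tr))
            (ℤ-solve 2 (λ q x → ((ℤ-con 1ℤ ⟨+⟩ q ⟨*⟩ x) ⟨+⟩ (ℤ-con 1ℤ ⟨+⟩ q ⟨*⟩ (⟨-⟩ x)) ⟨+⟩ ℤ-con 1ℤ) ⟨-⟩ ℤ-con 1ℤ ⟨=⟩ ℤ-con (ℤ.+ 2)) refl Q (eₙ a₁)))))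

      -- Here a₁ and the sum `s` lie in F_q. Their terms in Q have the same sign because Tr_n(a₂ +
      -- a₃) = 0, and they enter with opposite signs.
      bent₂ : Cond2 b a₁ a₂ a₃ → Bent (h3 b a₁ a₂ a₃)
      bent₂ (refl , a₂∉Fq , a₃∉Fq , a₂+a₃∈Fq , tr , tr₂) =
        h3-Bent (S-InFq a₁∈Fq) (S-∉Fq a₂∉Fq) (S-∉Fq a₃∉Fq)
          (S-InFq (subst InFq (sym (+-assoc a₁ a₂ a₃)) (InFq-+ a₁∈Fq a₂+a₃∈Fq)))
          (trans (2sgn0 (h3-0 refl a₁∈Fq tr₂)) (sym (trans
            (cong (λ z → ((1ℤ ⊕ Q ⊗ eₙ a₁) ⊕ 1ℤ ⊕ 1ℤ) ⊖ (1ℤ ⊕ Q ⊗ z)) eₙ-s)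
            (ℤ-solve 1 (λ y → ((ℤ-con 1ℤ ⟨+⟩ y) ⟨+⟩ ℤ-con 1ℤ ⟨+⟩ ℤ-con 1ℤ) ⟨-⟩ (ℤ-con 1ℤ ⟨+⟩ y) ⟨=⟩ ℤ-con (ℤ.+ 2)) refl (Q ⊗ eₙ a₁)))))
        where
        eₙ-s : eₙ s ≡ eₙ a₁
        eₙ-s = begin
          eₙ (a₁ + a₂ + a₃)         ≡⟨ cong eₙ (+-assoc a₁ a₂ a₃) ⟩
          eₙ (a₁ + (a₂ + a₃))       ≡⟨ eₙ-+ a₁∈Fq a₂+a₃∈Fq ⟩
          eₙ a₁ ⊗ eₙ (a₂ + a₃)      ≡⟨ cong (eₙ a₁ ⊗_) (trans (cong sgn tr) sgn-0) ⟩
          eₙ a₁ ⊗ 1ℤ                ≡⟨ ℤ.*-identityʳ _ ⟩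
          eₙ a₁                     ∎

      module _ (b∈U : InU b) (b≢1 : b ≢ 1#) where
        private
          b̄ = conj b
          bb̄ = InU⇒norm b∈U

        S-in : ∀ {a} → InFq (a * b̄) → S b a ≡ (Q ⊖ 1ℤ) ⊗ (1ℤ ⊕ Q ⊗ eₙ (a * b̄))
        S-in {a} p = trans (S-U b a bb̄) (S-InFq p)

        S-out : ∀ {a} → ¬ InFq (a * b̄) → S b a ≡ (Q ⊖ 1ℤ) ⊗ 1ℤ
        S-out {a} h = trans (S-U b a bb̄) (S-∉Fq h)

        -- Otherwise conj b ∈ F_q, hence b = conj b and b² = 1, which forces b = 1. So a₁ never
        -- contributes a term in Q when b ∈ U differs from 1.
        a₁b̄∉Fq : ¬ InFq (a₁ * b̄)
        a₁b̄∉Fq p = b≢1 (x+y≡0⇒x≡y (x²≡0⇒x≡0 (trans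
            (solve 1 (λ b → (b :+ con true) :* (b :+ con true) := b :* b :+ con true) refl b)
            (x≡y⇒x+y≡0 (trans (cong (b *_) (trans (sym (conj-conj b)) b̄∈Fq)) bb̄)))))
          where
          b̄∈Fq : InFq b̄
          b̄∈Fq = subst InFq (*-inv-cancelˡ a₁ b̄ a₁≢0) (InFq-* (InFq-inv a₁∈Fq) p)

        -- If a·conj b is fixed by conjugation it equals conj(a)·b, and the product of these two is
        -- the norm of a. As squares do not affect Tr_n, the conditions can be phrased with norms in
        -- place of a·conj b.
        norm-ab̄ : ∀ {a} → InFq (a * b̄) → a * conj a ≡ (a * b̄) * (a * b̄)
        norm-ab̄ {a} p = begin
          a * conj a                    ≡⟨ sym (*-identityʳ _) ⟩
          a * conj a * 1#               ≡⟨ cong (a * conj a *_) (sym bb̄) ⟩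
          a * conj a * (b * b̄)          ≡⟨ solve 4 (λ a v b c → a :* v :* (b :* c) := (a :* c) :* (v :* b)) refl a (conj a) b b̄ ⟩
          (a * b̄) * (conj a * b)        ≡⟨ cong ((a * b̄) *_) (trans (sym (trans (conj-* a b̄) (cong (conj a *_) (conj-conj b)))) p) ⟩
          (a * b̄) * (a * b̄)             ∎

        eₙ-norm : ∀ {a} → InFq (a * b̄) → eₙ (a * conj a) ≡ eₙ (a * b̄)
        eₙ-norm p = trans (cong eₙ (norm-ab̄ p)) (eₙ-sq p)

        -- The terms in Q come from a₂ and a₃ and cancel by the trace condition. The sum has none,
        -- since s·conj b differs from a₁·conj b by an element of F_q.
        bent₃ : Trn2n (a₂ * b̄) ≡ 0# → Trn2n (a₃ * b̄) ≡ 0# → Trn (a₂ * conj a₂ + a₃ * conj a₃) ≡ 1# →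
                h3 b a₁ a₂ a₃ 0# ≡ 0# → Bent (h3 b a₁ a₂ a₃)
        bent₃ t₂ t₃ tr h0 = h3-Bent (S-out a₁b̄∉Fq) (S-in p₂) (S-in p₃)
          (S-out (λ p → ¬InFq-+ (InFq-+ p₂ p₃) a₁b̄∉Fq
            (subst InFq (solve 4 (λ x y z b → (x :+ y :+ z) :* b := (y :* b :+ z :* b) :+ x :* b) refl a₁ a₂ a₃ b̄) p)))
          (trans (2sgn0 h0) (sym (trans
            (cong (λ z → (1ℤ ⊕ (1ℤ ⊕ Q ⊗ eₙ (a₂ * b̄)) ⊕ (1ℤ ⊕ Q ⊗ z)) ⊖ 1ℤ) opp)
            (ℤ-solve 2 (λ q x → (ℤ-con 1ℤ ⟨+⟩ (ℤ-con 1ℤ ⟨+⟩ q ⟨*⟩ x) ⟨+⟩ (ℤ-con 1ℤ ⟨+⟩ q ⟨*⟩ (⟨-⟩ x))) ⟨-⟩ ℤ-con 1ℤ ⟨=⟩ ℤ-con (ℤ.+ 2)) refl Q (eₙ (a₂ * b̄))))))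
          where
          p₂ = Trn2n≡0⇒InFq t₂
          p₃ = Trn2n≡0⇒InFq t₃
          opp : eₙ (a₃ * b̄) ≡ ℤ.- eₙ (a₂ * b̄)
          opp = trans (sym (eₙ-norm p₃)) (trans (eₙ-opposite (InFq-norm a₂) (InFq-norm a₃) tr) (cong ℤ.-_ (eₙ-norm p₂)))

        -- The terms in Q come from a₂ and `s`; equal traces of their norms make them cancel in the
        -- difference.
        bent₄ : Trn2n (a₂ * b̄) ≡ 0# → Trn2n (a₃ * b̄) ≢ 0# → Trn2n (s * b̄) ≡ 0# →
                Trn (a₂ * conj a₂) ≡ Trn (s * (a₁ + conj a₂ + conj a₃)) →
                h3 b a₁ a₂ a₃ 0# ≡ 0# → Bent (h3 b a₁ a₂ a₃)
        bent₄ t₂ t₃ t₄ tr h0 = h3-Bent (S-out a₁b̄∉Fq) (S-in p₂) (S-out (Trn2n≢0⇒∉Fq t₃)) (S-in p₄)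
          (trans (2sgn0 h0) (sym (trans
            (cong (λ z → (1ℤ ⊕ (1ℤ ⊕ Q ⊗ eₙ (a₂ * b̄)) ⊕ 1ℤ) ⊖ (1ℤ ⊕ Q ⊗ z)) eq)
            (ℤ-solve 1 (λ y → (ℤ-con 1ℤ ⟨+⟩ (ℤ-con 1ℤ ⟨+⟩ y) ⟨+⟩ ℤ-con 1ℤ) ⟨-⟩ (ℤ-con 1ℤ ⟨+⟩ y) ⟨=⟩ ℤ-con (ℤ.+ 2)) refl (Q ⊗ eₙ (a₂ * b̄))))))
          where
          p₂ = Trn2n≡0⇒InFq t₂
          p₄ = Trn2n≡0⇒InFq t₄
          conj-s : conj s ≡ a₁ + conj a₂ + conj a₃
          conj-s = trans (conj-+ _ _) (cong (_+ conj a₃) (trans (conj-+ a₁ a₂) (cong (_+ conj a₂) a₁∈Fq)))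
          eq : eₙ (s * b̄) ≡ eₙ (a₂ * b̄)
          eq = begin
            eₙ (s * b̄)                           ≡⟨ sym (eₙ-norm p₄) ⟩
            eₙ (s * conj s)                      ≡⟨ cong (λ z → eₙ (s * z)) conj-s ⟩
            eₙ (s * (a₁ + conj a₂ + conj a₃))    ≡⟨ cong sgn (sym tr) ⟩
            eₙ (a₂ * conj a₂)                    ≡⟨ eₙ-norm p₂ ⟩
            eₙ (a₂ * b̄)                          ∎

        -- No term in Q occurs: all four cofactors are 1.
        bent₅ : Trn2n (a₂ * b̄) ≢ 0# → Trn2n (a₃ * b̄) ≢ 0# → Trn2n (s * b̄) ≢ 0# →
                h3 b a₁ a₂ a₃ 0# ≡ 0# → Bent (h3 b a₁ a₂ a₃)
        bent₅ t₂ t₃ t₄ h0 = h3-Bent (S-out a₁b̄∉Fq) (S-out (Trn2n≢0⇒∉Fq t₂)) (S-out (Trn2n≢0⇒∉Fq t₃))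
          (S-out (Trn2n≢0⇒∉Fq t₄)) (2sgn0 h0)

      -- The majority identity applies to the bits u(a_i) as well, because `ufun b` is additive.
      -- Expanding that sign in the hypothesis groups it into the four cofactors found for b ∉ U.
      bent₆ : a₂ ≢ 0# → a₃ ≢ 0# → s ≢ 0# → Cond6 b a₁ a₂ a₃ → Bent (h3 b a₁ a₂ a₃)
      bent₆ a₂≢0 a₃≢0 s≢0 (b∉U , eq) = h3-Bent (S-∉U b a₁ bb̄ a₁≢0) (S-∉U b a₂ bb̄ a₂≢0) (S-∉U b a₃ bb̄ a₃≢0) (S-∉U b s bb̄ s≢0) (begin
        ℤ.+ 2 ⊗ sgn (h3 b a₁ a₂ a₃ 0#)
          ≡⟨ eq ⟩
        (ℤ.+ 2 ⊗ sgn (maj (u a₁) (u a₂) (u a₃)) ⊕ sgn (u s) ⊗ κ₄) ⊖ ((sgn (u a₁) ⊗ κ₁ ⊕ sgn (u a₂) ⊗ κ₂) ⊕ sgn (u a₃) ⊗ κ₃)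
          ≡⟨ cong (λ z → (z ⊕ sgn (u s) ⊗ κ₄) ⊖ ((sgn (u a₁) ⊗ κ₁ ⊕ sgn (u a₂) ⊗ κ₂) ⊕ sgn (u a₃) ⊗ κ₃))
               (trans (sgn-maj (Tr-Bit _) (Tr-Bit _) (Tr-Bit _)) (cong (λ z → (sgn (u a₁) ⊕ sgn (u a₂) ⊕ sgn (u a₃)) ⊖ sgn z) (sym u-s))) ⟩
        (((sgn (u a₁) ⊕ sgn (u a₂) ⊕ sgn (u a₃)) ⊖ sgn (u s)) ⊕ sgn (u s) ⊗ κ₄) ⊖ ((sgn (u a₁) ⊗ κ₁ ⊕ sgn (u a₂) ⊗ κ₂) ⊕ sgn (u a₃) ⊗ κ₃)
          ≡⟨ ℤ-solve 8 (λ s t v w x y z r →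
               (((s ⟨+⟩ t ⟨+⟩ v) ⟨-⟩ w) ⟨+⟩ w ⟨*⟩ r) ⟨-⟩ ((s ⟨*⟩ x ⟨+⟩ t ⟨*⟩ y) ⟨+⟩ v ⟨*⟩ z)
               ⟨=⟩ (s ⟨*⟩ (ℤ-con 1ℤ ⟨-⟩ x) ⟨+⟩ t ⟨*⟩ (ℤ-con 1ℤ ⟨-⟩ y) ⟨+⟩ v ⟨*⟩ (ℤ-con 1ℤ ⟨-⟩ z)) ⟨-⟩ w ⟨*⟩ (ℤ-con 1ℤ ⟨-⟩ r))
               refl (sgn (u a₁)) (sgn (u a₂)) (sgn (u a₃)) (sgn (u s)) κ₁ κ₂ κ₃ κ₄ ⟩
        (sgn (u a₁) ⊗ (1ℤ ⊖ κ₁) ⊕ sgn (u a₂) ⊗ (1ℤ ⊖ κ₂) ⊕ sgn (u a₃) ⊗ (1ℤ ⊖ κ₃)) ⊖ sgn (u s) ⊗ (1ℤ ⊖ κ₄) ∎)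
        where
        u = ufun b
        κ₁ = kfun b a₁
        κ₂ = kfun b a₂
        κ₃ = kfun b a₃
        κ₄ = kfun b s
        bb̄ : b * conj b ≢ 1#
        bb̄ p = b∉U (norm⇒InU p)
        u-s : u s ≡ u a₁ + u a₂ + u a₃
        u-s = trans (ufun-+ b (a₁ + a₂) a₃) (cong (_+ u a₃) (ufun-+ b a₁ a₂))

theorem3 : (n : ℕ) → n > 2 → (F : GF2^ (2 Data.Nat.* n)) →
    let open Setting n F in
    (b a₁ a₂ a₃ : Carrier) →
    b ≢ 0# → (InFq a₁ × a₁ ≢ 0#) → a₂ ≢ 0# → a₃ ≢ 0# →
    a₁ ≢ a₂ → a₁ ≢ a₃ → a₂ ≢ a₃ → a₁ + a₂ + a₃ ≢ 0# →
    (Cond1 b a₁ a₂ a₃ ⊎ Cond2 b a₁ a₂ a₃ ⊎ Cond3 b a₁ a₂ a₃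
    ⊎ Cond4 b a₁ a₂ a₃ ⊎ Cond5 b a₁ a₂ a₃ ⊎ Cond6 b a₁ a₂ a₃) →
    Bent (h3 b a₁ a₂ a₃)
theorem3 (suc k) _ F b a₁ a₂ a₃ _ (a₁∈Fq , a₁≢0) a₂≢0 a₃≢0 _ _ _ s≢0 = λ where
    (inj₁ c) → bent₁ b a₁ a₂ a₃ a₁∈Fq a₁≢0 c
    (inj₂ (inj₁ c)) → bent₂ b a₁ a₂ a₃ a₁∈Fq a₁≢0 c
    (inj₂ (inj₂ (inj₁ ((b∈U , b≢1) , t₂ , t₃ , tr , h0)))) → bent₃ b a₁ a₂ a₃ a₁∈Fq a₁≢0 b∈U b≢1 t₂ t₃ tr h0
    (inj₂ (inj₂ (inj₂ (inj₁ ((b∈U , b≢1) , t₂ , t₃ , t₄ , tr , h0))))) → bent₄ b a₁ a₂ a₃ a₁∈Fq a₁≢0 b∈U b≢1 t₂ t₃ t₄ tr h0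
    (inj₂ (inj₂ (inj₂ (inj₂ (inj₁ ((b∈U , b≢1) , t₂ , t₃ , t₄ , h0)))))) → bent₅ b a₁ a₂ a₃ a₁∈Fq a₁≢0 b∈U b≢1 t₂ t₃ t₄ h0
    (inj₂ (inj₂ (inj₂ (inj₂ (inj₂ c))))) → bent₆ b a₁ a₂ a₃ a₁∈Fq a₁≢0 a₂≢0 a₃≢0 s≢0 c
  where open Majority k F
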